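{- For every nonnegative integer $k$, the limit $\ell(k) := \lim_{n\to\infty} P_{n,M}(k)$ exists, where $P_{n,M}(k) := P(2n-1-|S-S| = k)$ for $S$ a uniformly random subset of $[n]=\{0,\dots,n-1\}$. Moreover $\ell(k) > 0$ if and only if $k$ is even, $\sum_{k=0}^\infty \ell(k) = 1$, and \[ \ell(10) < \ell(8) < \ell(0) < \ell(6) < \ell(2) < \ell(4). \]
   Context: For a positive integer $n$, $[n] := \{0,1,\dots,n-1\}$, and $S$ is chosen uniformly at random among all $2^n$ subsets of $[n]$. The difference set is $S-S := \{x-y : x,y \in S\}$. -}

module Defs where

open import Data.Bool using (Bool; true; false)
open import Data.Nat as ℕ using (ℕ; zero; suc; _∸_; _^_)
open import Data.Nat.Properties using (m^n≢0)
open import Data.Integer as ℤ using (ℤ; +_)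
open import Data.Fin using (Fin; toℕ)
open import Data.Fin.Subset using (Subset; _∈_)
open import Data.Fin.Subset.Properties using (_∈?_)
open import Data.List using (List; []; _∷_; _++_; map; length; filter; allFin; upTo; foldr)
open import Data.List.Relation.Unary.Any using (Any; any?)
open import Data.Vec using (Vec; []; _∷_)
open import Data.Rational as ℚ using (ℚ; 0ℚ; 1ℚ)
open import Data.Product using (Σ; ∃; _×_; _,_)
open import Relation.Binary.PropositionalEquality using (_≡_)
open import Relation.Nullary using (Dec)
open import Relation.Nullary.Decidable using (_×-dec_)

allSubsets : (n : ℕ) → List (Subset n)
allSubsets zero    = [] ∷ []
allSubsets (suc n) = map (false ∷_) (allSubsets n) ++ map (true ∷_) (allSubsets n)

InDiff : {n : ℕ} → Subset n → ℤ → Set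
InDiff {n} S d =
  Any (λ x → Any (λ y → x ∈ S × y ∈ S × ((+ toℕ x) ℤ.- (+ toℕ y) ≡ d)) (allFin n)) (allFin n)

inDiff? : {n : ℕ} (S : Subset n) (d : ℤ) → Dec (InDiff S d)
inDiff? {n} S d =
  any? (λ x → any? (λ y → (x ∈? S) ×-dec ((y ∈? S) ×-dec ((+ toℕ x) ℤ.- (+ toℕ y) ℤ.≟ d))) (allFin n)) (allFin n)

-- Every element of S - S lies in {-(n-1), ..., n-1}; candidates listed here.
diffRange : ℕ → List ℤ
diffRange n = map (λ i → (+ i) ℤ.- (+ (n ∸ 1))) (upTo ((2 ℕ.* n) ∸ 1))

diffCard : {n : ℕ} → Subset n → ℕ
diffCard {n} S = length (filter (inDiff? S) (diffRange n))

missing : {n : ℕ} → Subset n → ℕ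
missing {n} S = ((2 ℕ.* n) ∸ 1) ∸ diffCard S

countMissing : ℕ → ℕ → ℕ
countMissing n k = length (filter (λ S → missing S ℕ.≟ k) (allSubsets n))

P : ℕ → ℕ → ℚ
P n k = (+ countMissing n k) ℚ./ (2 ^ n)
  where instance _ = m^n≢0 2 n

-- Limits of rational sequences, expressed without real numbers.

Eventually : (ℕ → Set) → Set
Eventually Q = ∃ λ N → ∀ n → N ℕ.≤ n → Q n

-- lim a exists (in ℝ) : a is Cauchy
LimitExists : (ℕ → ℚ) → Set
LimitExists a = ∀ (ε : ℚ) → 0ℚ ℚ.< ε →
  ∃ λ N → ∀ m n → N ℕ.≤ m → N ℕ.≤ n → ℚ.∣ a m ℚ.- a n ∣ ℚ.< ε

-- lim a > 0  (given the limit exists)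
LimitPositive : (ℕ → ℚ) → Set
LimitPositive a = ∃ λ (q : ℚ) → 0ℚ ℚ.< q × Eventually (λ n → q ℚ.≤ a n)

-- lim a < lim b  (given both limits exist)
LimitLess : (ℕ → ℚ) → (ℕ → ℚ) → Set
LimitLess a b = ∃ λ (q : ℚ) → 0ℚ ℚ.< q × Eventually (λ n → a n ℚ.+ q ℚ.≤ b n)

sumℚ : List ℚ → ℚ
sumℚ = foldr ℚ._+_ 0ℚ

partialSum : ℕ → ℕ → ℚ
partialSum n K = sumℚ (map (P n) (upTo K))

-- Σ_{k≥0} lim_n P_{n,M}(k) = 1, i.e. for every ε > 0 some partial sum
-- Σ_{k<K} ℓ(k) = lim_n Σ_{k<K} P_{n,M}(k) exceeds 1 - ε
-- (partial sums of ℓ are automatically ≤ 1 as Σ_k P_{n,M}(k) = 1).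
LimitsSumToOne : Set
LimitsSumToOne = ∀ (ε : ℚ) → 0ℚ ℚ.< ε →
  ∃ λ K → Eventually (λ n → 1ℚ ℚ.- ε ℚ.< partialSum n K)

module Submission where

open import Defs
open import Data.Bool using (Bool; true; false; _∧_; _∨_; if_then_else_; T)
open import Data.Bool.Properties using (T-∧; ∨-zeroʳ)
open import Data.Fin as Fin using (toℕ)
open import Data.Fin.Subset using (Subset; _∈_)
open import Data.Integer as ℤ using (ℤ) renaming (+_ to pos)
import Data.Integer.Properties as ℤₚ
import Data.Integer.Tactic.RingSolver as ℤ-Solver
open import Data.List using (List; []; _∷_; _++_; _∷ʳ_; length; reverse; drop; take; map; filter; applyUpTo)
open import Data.List.Membership.Propositional using (lose)
open import Data.List.Membership.Propositional.Properties using (∈-allFin)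
open import Data.List.Properties using (length-++; ++-assoc; ++-identityʳ; reverse-++; unfold-reverse;
  length-reverse; reverse-involutive; ∷ʳ-++; length-drop; drop-drop; filter-++)
open import Data.List.Relation.Unary.Any using (satisfied)
open import Data.Nat hiding (parity)
open import Data.Nat.Divisibility using (_∣_; divides; m∣m*n)
open import Data.Nat.DivMod using (m≡m%n+[m/n]*n; m%n<n; m≥n⇒m/n>0; m/n*n≤m; /-monoˡ-≤; m*n/n≡m)
open import Data.Nat.Properties
open import Data.Nat.Tactic.RingSolver using (solve-∀)
open import Data.Product using (_×_; _,_; proj₁; proj₂; ∃)
open import Data.Rational as ℚ using (ℚ; 0ℚ; 1ℚ; mkℚ; toℚᵘ)
import Data.Rational.Properties as ℚₚ
open import Data.Rational.Unnormalised as ℚᵘ using (mkℚᵘ)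
import Data.Rational.Unnormalised.Properties as ℚᵘₚ
open import Data.Sum using (_⊎_; inj₁; inj₂)
open import Data.Vec as Vec using (toList; here; there)
open import Algebra.Properties.Group ℚₚ.+-0-group using (⁻¹-involutive)
open import Function using (_∘_; id)
open import Function.Bundles using (_⇔_; mk⇔; Equivalence)
open import Level using (0ℓ)
open import Relation.Binary.PropositionalEquality
open import Relation.Nullary using (¬_; Dec; yes; no; does; contradiction)
open import Relation.Unary using (Pred; Decidable)

-- For a subset S of [n] and j < n / 2, the difference n - 1 - j is present exactly when j ∈ A + B, where A and
-- n - 1 - B are the initial and final halves of S.  Smaller differences are missing with exponentially small probability,
-- so 2 n - 1 - |S - S| is essentially twice the number of j < n / 2 outside A + B for independent uniformly
-- random A and B.  As j ∉ A + B has probability (3/4)^(j + 1), this distribution converges, and Markov's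
-- inequality gives total mass 1.  For the strict inequalities, condition on the first nonzero elements of A
-- and B, which leaves linear functionals of the distribution given 0 ∈ A and 0 ∈ B.  These are bounded from
-- below by a search over initial segments of (A , B), where the expected number of further gaps, which is
-- an explicit martingale, controls the error at each leaf.

-- Sums over words

-- The gaps of A + B are dependent and the limits have no evident closed form, so the inequalities
-- have to come from a finite computation with rigorous tails. Conditioning on 0 ∈ A and 0 ∈ B
-- lowers the expected number of gaps from 3 to 1 (further ones included), and it is invertible:
-- each leading zero costs a factor 1/2 and one gap, so the unconditioned law is the conditioned one
-- times (1/4) (1 - x/2)⁻² as generating functions. Hence a comparison of two limits becomes the
-- claim that an explicit function of the number of gaps, constant from some point on, has
-- conditioned mean above that constant. At a leaf the function is bounded by its present value
-- minus a slope times the expected number of further gaps. All probabilities are kept as counts of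
-- pairs of words of length h, out of 4 ^ h, with errors of order 3 ^ h. Negative terms are moved to
-- the other side, so that only natural numbers occur until the rational statements, and a
-- certificate is one evaluation in the naturals.

Word : Set
Word = List Bool

sumW : ℕ → (Word → ℕ) → ℕ
sumW zero    F = F []
sumW (suc n) F = sumW n (F ∘ (false ∷_)) + sumW n (F ∘ (true ∷_))

sumW-cong : ∀ n {F G : Word → ℕ} → (∀ u → length u ≡ n → F u ≡ G u) → sumW n F ≡ sumW n G
sumW-cong zero    h = h [] refl
sumW-cong (suc n) h =
  cong₂ _+_ (sumW-cong n λ u l → h _ (cong suc l)) (sumW-cong n λ u l → h _ (cong suc l))

sumW-mono : ∀ n {F G : Word → ℕ} → (∀ u → length u ≡ n → F u ≤ G u) → sumW n F ≤ sumW n G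
sumW-mono zero    h = h [] refl
sumW-mono (suc n) h =
  +-mono-≤ (sumW-mono n λ u l → h _ (cong suc l)) (sumW-mono n λ u l → h _ (cong suc l))

interchange : ∀ a b c d → (a + b) + (c + d) ≡ (a + c) + (b + d)
interchange = solve-∀

sumW-+ : ∀ n (F G : Word → ℕ) → sumW n (λ u → F u + G u) ≡ sumW n F + sumW n G
sumW-+ zero    F G = refl
sumW-+ (suc n) F G = trans
  (cong₂ _+_ (sumW-+ n (F ∘ (false ∷_)) (G ∘ (false ∷_))) (sumW-+ n (F ∘ (true ∷_)) (G ∘ (true ∷_))))
  (interchange (sumW n (F ∘ (false ∷_))) _ _ _)

sumW-* : ∀ n c (F : Word → ℕ) → sumW n (λ u → c * F u) ≡ c * sumW n F
sumW-* zero    c F = refl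
sumW-* (suc n) c F = trans
  (cong₂ _+_ (sumW-* n c (F ∘ (false ∷_))) (sumW-* n c (F ∘ (true ∷_))))
  (sym (*-distribˡ-+ c (sumW n (F ∘ (false ∷_))) _))

sumW-const : ∀ n c → sumW n (λ _ → c) ≡ 2 ^ n * c
sumW-const zero    c = sym (+-identityʳ c)
sumW-const (suc n) c = trans (cong (λ s → s + s) (sumW-const n c)) (lemma (2 ^ n) c)
  where
  lemma : ∀ p c → p * c + p * c ≡ 2 * p * c
  lemma = solve-∀

sumW-++ : ∀ m n (F : Word → ℕ) → sumW (m + n) F ≡ sumW m (λ u → sumW n (λ v → F (u ++ v)))
sumW-++ zero    n F = refl
sumW-++ (suc m) n F = cong₂ _+_ (sumW-++ m n _) (sumW-++ m n _)

sumW-∷ʳ : ∀ n (F : Word → ℕ) →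
  sumW (suc n) F ≡ sumW n (λ u → F (u ∷ʳ false)) + sumW n (λ u → F (u ∷ʳ true))
sumW-∷ʳ zero    F = refl
sumW-∷ʳ (suc n) F = trans
  (cong₂ _+_ (sumW-∷ʳ n (F ∘ (false ∷_))) (sumW-∷ʳ n (F ∘ (true ∷_))))
  (interchange (sumW n (λ u → F (false ∷ u ∷ʳ false))) _ _ _)

sumW-swap : ∀ m n (F : Word → Word → ℕ) →
  sumW m (λ u → sumW n (F u)) ≡ sumW n (λ v → sumW m (λ u → F u v))
sumW-swap zero    n F = refl
sumW-swap (suc m) n F = trans
  (cong₂ _+_ (sumW-swap m n (λ u → F (false ∷ u))) (sumW-swap m n (λ u → F (true ∷ u))))
  (sym (sumW-+ n (λ v → sumW m (λ u → F (false ∷ u) v)) _))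

four : (Bool → Bool → ℕ) → ℕ
four f = (f false false + f false true) + (f true false + f true true)

four-cong : ∀ {f g : Bool → Bool → ℕ} → (∀ a b → f a b ≡ g a b) → four f ≡ four g
four-cong h = cong₂ _+_ (cong₂ _+_ (h _ _) (h _ _)) (cong₂ _+_ (h _ _) (h _ _))

four-mono : ∀ {f g : Bool → Bool → ℕ} → (∀ a b → f a b ≤ g a b) → four f ≤ four g
four-mono h = +-mono-≤ (+-mono-≤ (h _ _) (h _ _)) (+-mono-≤ (h _ _) (h _ _))

four-+ : ∀ (f g : Bool → Bool → ℕ) → four (λ a b → f a b + g a b) ≡ four f + four g
four-+ f g = lemma (f false false) (f false true) (f true false) (f true true)
                   (g false false) (g false true) (g true false) (g true true)
  where
  lemma : ∀ a b c d e f g h → ((a + e) + (b + f)) + ((c + g) + (d + h)) ≡ ((a + b) + (c + d)) + ((e + f) + (g + h))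
  lemma = solve-∀

four-* : ∀ c (f : Bool → Bool → ℕ) → four (λ a b → c * f a b) ≡ c * four f
four-* c f = lemma c (f false false) (f false true) (f true false) (f true true)
  where
  lemma : ∀ k a b c d → (k * a + k * b) + (k * c + k * d) ≡ k * ((a + b) + (c + d))
  lemma = solve-∀

four-const : ∀ c → four (λ _ _ → c) ≡ 4 * c
four-const = lemma
  where
  lemma : ∀ c → (c + c) + (c + c) ≡ 4 * c
  lemma = solve-∀

-- `u` holds A forwards and grows at its end, `v` holds B backwards and grows at its head. For words
-- of equal length, equal positions are therefore the pairs of indices whose sum is the newest
-- index.
Ext : ℕ → Word → Word → (Word → Word → ℕ) → ℕ
Ext zero    u v G = G u v
Ext (suc r) u v G = four (λ a b → Ext r (u ∷ʳ a) (b ∷ v) G)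

Ext-sumW : ∀ r u v G → Ext r u v G ≡ sumW r (λ u′ → sumW r (λ v′ → G (u ++ u′) (v′ ++ v)))
Ext-sumW zero    u v G = cong (λ w → G w v) (sym (++-identityʳ u))
Ext-sumW (suc r) u v G = trans
  (four-cong λ a b → trans (Ext-sumW r (u ∷ʳ a) (b ∷ v) G)
    (sumW-cong r λ u′ _ → sumW-cong r λ v′ _ →
      cong₂ G (++-assoc u (a ∷ []) u′) (sym (++-assoc v′ (b ∷ []) v))))
  (cong₂ _+_ (half false) (half true))
  where
  half : ∀ a → sumW r (λ u′ → sumW r (λ v′ → G (u ++ a ∷ u′) ((v′ ∷ʳ false) ++ v)))
             + sumW r (λ u′ → sumW r (λ v′ → G (u ++ a ∷ u′) ((v′ ∷ʳ true) ++ v)))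
             ≡ sumW r (λ u′ → sumW (suc r) (λ v′ → G (u ++ a ∷ u′) (v′ ++ v)))
  half a = trans (sym (sumW-+ r _ _)) (sumW-cong r λ u′ _ → sym (sumW-∷ʳ r (λ v′ → G (u ++ a ∷ u′) (v′ ++ v))))

-- The definition peels the earliest new letters, whereas a new gap is decided once the latest ones
-- are added.
Ext-last : ∀ r u v G → Ext (suc r) u v G ≡ Ext r u v (λ u′ v′ → four (λ a b → G (u′ ∷ʳ a) (b ∷ v′)))
Ext-last zero    u v G = refl
Ext-last (suc r) u v G = four-cong λ a b → Ext-last r (u ∷ʳ a) (b ∷ v) G

Ext-+ : ∀ r u v F G → Ext r u v (λ u v → F u v + G u v) ≡ Ext r u v F + Ext r u v G
Ext-+ zero    u v F G = refl
Ext-+ (suc r) u v F G = trans (four-cong λ a b → Ext-+ r (u ∷ʳ a) (b ∷ v) F G)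
  (four-+ (λ a b → Ext r (u ∷ʳ a) (b ∷ v) F) (λ a b → Ext r (u ∷ʳ a) (b ∷ v) G))

Ext-* : ∀ r u v c F → Ext r u v (λ u v → c * F u v) ≡ c * Ext r u v F
Ext-* zero    u v c F = refl
Ext-* (suc r) u v c F = trans (four-cong λ a b → Ext-* r (u ∷ʳ a) (b ∷ v) c F)
  (four-* c (λ a b → Ext r (u ∷ʳ a) (b ∷ v) F))

Ext-const : ∀ r u v c → Ext r u v (λ _ _ → c) ≡ 4 ^ r * c
Ext-const zero    u v c = sym (+-identityʳ c)
Ext-const (suc r) u v c = trans (four-cong λ a b → Ext-const r (u ∷ʳ a) (b ∷ v) c)
  (trans (four-const (4 ^ r * c)) (sym (*-assoc 4 (4 ^ r) c)))

-- Gaps in sumsets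

hit : Word → Word → Bool
hit (true ∷ u) (true ∷ v) = true
hit (_    ∷ u) (_    ∷ v) = hit u v
hit _          _          = false

gap : Bool → ℕ
gap true  = 0
gap false = 1

hit-∷ : ∀ a u b v → hit (a ∷ u) (b ∷ v) ≡ (a ∧ b) ∨ hit u v
hit-∷ true  u true  v = refl
hit-∷ true  u false v = refl
hit-∷ false u _     v = refl

hit-[] : ∀ u → hit u [] ≡ false
hit-[] []          = refl
hit-[] (true  ∷ u) = refl
hit-[] (false ∷ u) = refl

-- With A listed forwards in u and B backwards in v, the suffix of v of length j + 1 meets u if and only if
-- j ∈ A + B; hence miss counts the j < length v outside A + B.
miss : Word → Word → ℕ
miss u []      = 0
miss u (b ∷ v) = gap (hit u (b ∷ v)) + miss u v

hit-++ˡ : ∀ u x v → length v ≤ length u → hit (u ++ x) v ≡ hit u v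
hit-++ˡ []      x []      _       = hit-[] x
hit-++ˡ (a ∷ u) x []      _       = trans (hit-[] (a ∷ u ++ x)) (sym (hit-[] (a ∷ u)))
hit-++ˡ (a ∷ u) x (b ∷ v) (s≤s l) = begin
  hit (a ∷ u ++ x) (b ∷ v)   ≡⟨ hit-∷ a (u ++ x) b v ⟩
  (a ∧ b) ∨ hit (u ++ x) v   ≡⟨ cong ((a ∧ b) ∨_) (hit-++ˡ u x v l) ⟩
  (a ∧ b) ∨ hit u v          ≡⟨ hit-∷ a u b v ⟨
  hit (a ∷ u) (b ∷ v)        ∎
  where open ≡-Reasoning

hit-sym : ∀ u v → hit u v ≡ hit v u
hit-sym []      v       = sym (hit-[] v)
hit-sym (a ∷ u) []      = hit-[] (a ∷ u)
hit-sym (true  ∷ u) (true  ∷ v) = refl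
hit-sym (true  ∷ u) (false ∷ v) = hit-sym u v
hit-sym (false ∷ u) (true  ∷ v) = hit-sym u v
hit-sym (false ∷ u) (false ∷ v) = hit-sym u v

hit-++ʳ : ∀ u v x → length u ≤ length v → hit u (v ++ x) ≡ hit u v
hit-++ʳ u v x l = trans (hit-sym u (v ++ x)) (trans (hit-++ˡ v x u l) (hit-sym v u))

hit-∷ʳ : ∀ u v a b → length u ≡ length v → hit (u ∷ʳ a) (v ∷ʳ b) ≡ hit u v ∨ (a ∧ b)
hit-∷ʳ []      []      true  true  _ = refl
hit-∷ʳ []      []      true  false _ = refl
hit-∷ʳ []      []      false b     _ = refl
hit-∷ʳ (true  ∷ u) (true  ∷ v) a b l = refl
hit-∷ʳ (true  ∷ u) (false ∷ v) a b l = hit-∷ʳ u v a b (suc-injective l)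
hit-∷ʳ (false ∷ u) (d ∷ v)     a b l = hit-∷ʳ u v a b (suc-injective l)

miss-++ˡ : ∀ u x v → length v ≤ length u → miss (u ++ x) v ≡ miss u v
miss-++ˡ u x []      l = refl
miss-++ˡ u x (b ∷ v) l = cong₂ _+_ (cong gap (hit-++ˡ u x (b ∷ v) l)) (miss-++ˡ u x v (≤-trans (n≤1+n _) l))

miss-step : ∀ u v a b → length v ≤ length u →
  miss (u ∷ʳ a) (b ∷ v) ≡ gap (hit (u ∷ʳ a) (b ∷ v)) + miss u v
miss-step u v a b l = cong (gap (hit (u ∷ʳ a) (b ∷ v)) +_) (miss-++ˡ u (a ∷ []) v l)

-- The expected number of gaps in the extensions of two words

weight : Bool → ℕ
weight true  = 1
weight false = 2

-- For the index reached after i > 0 further steps, the first letters of A and of B are both paired with unknown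
-- letters; they contribute the factors weight / 2 and can be removed.
Φ : ℕ → Word → Word → ℕ
Φ zero    A       B       = 4 ^ length A * gap (hit A (reverse B))
Φ (suc i) (a ∷ A) (b ∷ B) = 4 * (weight a * weight b) * Φ i A B
Φ (suc i) []      _       = 3 ^ suc i
Φ (suc i) (_ ∷ _) []      = 3 ^ suc i

Φ-[] : ∀ i → Φ i [] [] ≡ 3 ^ i
Φ-[] zero    = refl
Φ-[] (suc i) = refl

length-∷ʳ : ∀ (A : Word) a → length (A ∷ʳ a) ≡ suc (length A)
length-∷ʳ A a = trans (length-++ A) (+-comm (length A) 1)

reverse-∷-∷ʳ : ∀ b₀ (B : Word) b → reverse (b₀ ∷ B ∷ʳ b) ≡ b ∷ (reverse B ∷ʳ b₀)
reverse-∷-∷ʳ b₀ B b = trans (unfold-reverse b₀ (B ∷ʳ b)) (cong (_∷ʳ b₀) (reverse-++ B (b ∷ [])))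

-- The new `b` is paired with `a₀` and the new `a` with `b₀`. An old letter that is present forces
-- its partner to be absent; one that is absent leaves its partner free.
four-gap : ∀ a₀ b₀ h → four (λ a b → gap ((a₀ ∧ b) ∨ (h ∨ (a ∧ b₀)))) ≡ weight a₀ * weight b₀ * gap h
four-gap false false false = refl
four-gap false false true  = refl
four-gap false true  false = refl
four-gap false true  true  = refl
four-gap true  false false = refl
four-gap true  false true  = refl
four-gap true  true  false = refl
four-gap true  true  true  = refl

-- The martingale property: `Φ i A B / 4 ^ (i + length A)` is the probability of a gap at a fixed
-- index, and its mean over the next pair of letters is unchanged. First letters are stripped until
-- no step is left, where `four-gap` applies, or the words are used up.
Φ-four : ∀ i A B → length A ≡ length B → four (λ a b → Φ i (A ∷ʳ a) (B ∷ʳ b)) ≡ 4 * Φ (suc i) A B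
Φ-four zero    []       []       _ = refl
Φ-four (suc i) []       []       _ = trans (cong sum (Φ-[] i)) (lemma (3 ^ i))
  where
  sum : ℕ → ℕ
  sum p = (16 * p + 8 * p) + (8 * p + 4 * p)
  lemma : ∀ p → (16 * p + 8 * p) + (8 * p + 4 * p) ≡ 4 * (3 * (3 * p))
  lemma = solve-∀
Φ-four zero (a₀ ∷ A) (b₀ ∷ B) l = begin
  four (λ a b → Φ 0 (a₀ ∷ A ∷ʳ a) (b₀ ∷ B ∷ʳ b))
    ≡⟨ four-cong (λ a b → cong₂ (λ n c → 4 ^ suc n * gap c) (length-∷ʳ A a) (split a b)) ⟩
  four (λ a b → 4 ^ suc (suc (length A)) * gap ((a₀ ∧ b) ∨ (h ∨ (a ∧ b₀))))
    ≡⟨ four-* (4 ^ suc (suc (length A))) (λ a b → gap ((a₀ ∧ b) ∨ (h ∨ (a ∧ b₀)))) ⟩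
  4 ^ suc (suc (length A)) * four (λ a b → gap ((a₀ ∧ b) ∨ (h ∨ (a ∧ b₀))))
    ≡⟨ cong (4 ^ suc (suc (length A)) *_) (four-gap a₀ b₀ h) ⟩
  4 ^ suc (suc (length A)) * (weight a₀ * weight b₀ * gap h)
    ≡⟨ lemma (4 ^ length A) (weight a₀ * weight b₀) (gap h) ⟩
  4 * (4 * (weight a₀ * weight b₀) * (4 ^ length A * gap h)) ∎
  where
  open ≡-Reasoning
  h = hit A (reverse B)
  split : ∀ a b → hit (a₀ ∷ A ∷ʳ a) (reverse (b₀ ∷ B ∷ʳ b)) ≡ (a₀ ∧ b) ∨ (h ∨ (a ∧ b₀))
  split a b = trans (cong (hit (a₀ ∷ A ∷ʳ a)) (reverse-∷-∷ʳ b₀ B b))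
    (trans (hit-∷ a₀ (A ∷ʳ a) b (reverse B ∷ʳ b₀))
      (cong ((a₀ ∧ b) ∨_) (hit-∷ʳ A (reverse B) a b₀ (trans (suc-injective l) (sym (length-reverse B))))))
  lemma : ∀ p q r → 4 * (4 * p) * (q * r) ≡ 4 * (4 * q * (p * r))
  lemma = solve-∀
Φ-four (suc i) (a₀ ∷ A) (b₀ ∷ B) l = trans
  (four-* (4 * (weight a₀ * weight b₀)) (λ a b → Φ i (A ∷ʳ a) (B ∷ʳ b)))
  (trans (cong (4 * (weight a₀ * weight b₀) *_) (Φ-four i A B (suc-injective l)))
    (lemma (4 * (weight a₀ * weight b₀)) (Φ (suc i) A B)))
  where
  lemma : ∀ p q → p * (4 * q) ≡ 4 * (p * q)
  lemma = solve-∀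

-- B is the second word read backwards.
Ext-gap : ∀ i A B → length A ≡ length B →
  4 ^ length A * Ext i A (reverse B) (λ u v → gap (hit u v)) ≡ Φ i A B
Ext-gap zero    A B l = refl
Ext-gap (suc i) A B l = *-cancelˡ-≡ _ _ 4 (begin
  4 * (4 ^ length A * Ext (suc i) A (reverse B) G)
    ≡⟨ *-assoc 4 (4 ^ length A) _ ⟨
  4 ^ suc (length A) * Ext (suc i) A (reverse B) G
    ≡⟨ four-* (4 ^ suc (length A)) (λ a b → Ext i (A ∷ʳ a) (b ∷ reverse B) G) ⟨
  four (λ a b → 4 ^ suc (length A) * Ext i (A ∷ʳ a) (b ∷ reverse B) G)
    ≡⟨ four-cong (λ a b → step a b) ⟩
  four (λ a b → Φ i (A ∷ʳ a) (B ∷ʳ b))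
    ≡⟨ Φ-four i A B l ⟩
  4 * Φ (suc i) A B ∎)
  where
  open ≡-Reasoning
  G = λ u v → gap (hit u v)
  step : ∀ a b → 4 ^ suc (length A) * Ext i (A ∷ʳ a) (b ∷ reverse B) G ≡ Φ i (A ∷ʳ a) (B ∷ʳ b)
  step a b = trans
    (cong₂ (λ n v → 4 ^ n * Ext i (A ∷ʳ a) v G) (sym (length-∷ʳ A a)) (sym (reverse-++ B (b ∷ []))))
    (Ext-gap i (A ∷ʳ a) (B ∷ʳ b) (trans (length-∷ʳ A a) (trans (cong suc l) (sym (length-∷ʳ B b)))))

-- `4 ^ r` times the sum of `Φ i A B / 4 ^ i` over 1 ≤ i ≤ r.
ΣΦ : ℕ → Word → Word → ℕ
ΣΦ zero    A B = 0
ΣΦ (suc r) A B = 4 * ΣΦ r A B + Φ (suc r) A B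

ΣΦ-[] : ∀ r → ΣΦ r [] [] + 3 * 3 ^ r ≡ 3 * 4 ^ r
ΣΦ-[] zero    = refl
ΣΦ-[] (suc r) = begin
  4 * ΣΦ r [] [] + 3 * 3 ^ r + 3 * (3 * 3 ^ r)  ≡⟨ lemma (ΣΦ r [] []) (3 ^ r) ⟩
  4 * (ΣΦ r [] [] + 3 * 3 ^ r)                  ≡⟨ cong (4 *_) (ΣΦ-[] r) ⟩
  4 * (3 * 4 ^ r)                               ≡⟨ lemma′ (4 ^ r) ⟩
  3 * (4 * 4 ^ r)                               ∎
  where
  open ≡-Reasoning
  lemma : ∀ s p → 4 * s + 3 * p + 3 * (3 * p) ≡ 4 * (s + 3 * p)
  lemma = solve-∀
  lemma′ : ∀ p → 4 * (3 * p) ≡ 3 * (4 * p)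
  lemma′ = solve-∀

-- Stripping the first letters turns step i + 1 into step i, so the shifted sum begins with
-- `Φ 0 A B`, which known letters already decide.
ΣΦ-∷ : ∀ r a A b B →
  ΣΦ (suc r) (a ∷ A) (b ∷ B) ≡ 4 * (weight a * weight b) * (4 ^ r * Φ 0 A B + ΣΦ r A B)
ΣΦ-∷ zero    a A b B = lemma (4 * (weight a * weight b)) (Φ 0 A B)
  where
  lemma : ∀ c p → c * p ≡ c * (p + 0 + 0)
  lemma = solve-∀
ΣΦ-∷ (suc r) a A b B = trans
  (cong (λ s → 4 * s + c * Φ (suc r) A B) (ΣΦ-∷ r a A b B))
  (lemma c (4 ^ r) (Φ 0 A B) (ΣΦ r A B) (Φ (suc r) A B))
  where
  c = 4 * (weight a * weight b)
  lemma : ∀ c q p s t → 4 * (c * (q * p + s)) + c * t ≡ c * (4 * q * p + (4 * s + t))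
  lemma = solve-∀

-- Horner evaluation of Σ_{i ≥ 1} Φ i A B / 4 ^ i, where v is the reversal of B followed by any word;
-- the base case is Σ_{i ≥ 1} (3/4) ^ i.
tailBound : Word → Word → Word → ℕ
tailBound (a ∷ A) (b ∷ B) v =
  weight a * (weight b * (if hit A v then tailBound A B v else 4 ^ length A + tailBound A B v))
tailBound _       _       v = 3

tailBound-∷ : ∀ a A b B v → tailBound (a ∷ A) (b ∷ B) v
  ≡ weight a * weight b * (4 ^ length A * gap (hit A v) + tailBound A B v)
tailBound-∷ a A b B v with hit A v
... | true  = lemma (weight a) (weight b) (tailBound A B v) (4 ^ length A)
  where
  lemma : ∀ x y t p → x * (y * t) ≡ x * y * (p * 0 + t)
  lemma = solve-∀
... | false = lemma (weight a) (weight b) (tailBound A B v) (4 ^ length A)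
  where
  lemma : ∀ x y t p → x * (y * (p + t)) ≡ x * y * (p * 1 + t)
  lemma = solve-∀

-- The suffix `x` is arbitrary because stripping `b` from B leaves the third word as it is: it now
-- reads as the reversal of the shorter B followed by `b ∷ x`.
ΣΦ≤tailBound : ∀ r A B x → length A ≡ length B → ΣΦ r A B ≤ 4 ^ r * tailBound A B (reverse B ++ x)
ΣΦ≤tailBound zero    A       B       x l = z≤n
ΣΦ≤tailBound (suc r) []      []      x l =
  ≤-trans (m≤m+n _ _) (≤-reflexive (trans (ΣΦ-[] (suc r)) (*-comm 3 (4 ^ suc r))))
ΣΦ≤tailBound (suc r) (a ∷ A) (b ∷ B) x l = begin
  ΣΦ (suc r) (a ∷ A) (b ∷ B)
    ≡⟨ ΣΦ-∷ r a A b B ⟩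
  4 * (weight a * weight b) * (4 ^ r * Φ 0 A B + ΣΦ r A B)
    ≤⟨ *-monoʳ-≤ (4 * (weight a * weight b)) (+-monoʳ-≤ (4 ^ r * Φ 0 A B) (ΣΦ≤tailBound r A B (b ∷ x) (suc-injective l))) ⟩
  4 * (weight a * weight b) * (4 ^ r * Φ 0 A B + 4 ^ r * tailBound A B (reverse B ++ b ∷ x))
    ≡⟨ lemma (weight a * weight b) (4 ^ r) (Φ 0 A B) (tailBound A B (reverse B ++ b ∷ x)) ⟩
  4 ^ suc r * (weight a * weight b * (Φ 0 A B + tailBound A B (reverse B ++ b ∷ x)))
    ≡⟨ cong (λ h → 4 ^ suc r * (weight a * weight b * (4 ^ length A * gap h + tailBound A B (reverse B ++ b ∷ x))))
         (hit-++ʳ A (reverse B) (b ∷ x) (≤-reflexive (trans (suc-injective l) (sym (length-reverse B))))) ⟨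
  4 ^ suc r * (weight a * weight b * (4 ^ length A * gap (hit A (reverse B ++ b ∷ x)) + tailBound A B (reverse B ++ b ∷ x)))
    ≡⟨ cong (4 ^ suc r *_) (tailBound-∷ a A b B (reverse B ++ b ∷ x)) ⟨
  4 ^ suc r * tailBound (a ∷ A) (b ∷ B) (reverse B ++ b ∷ x)
    ≡⟨ cong (λ v → 4 ^ suc r * tailBound (a ∷ A) (b ∷ B) v)
         (trans (sym (∷ʳ-++ (reverse B) b x)) (cong (_++ x) (sym (unfold-reverse b B)))) ⟩
  4 ^ suc r * tailBound (a ∷ A) (b ∷ B) (reverse (b ∷ B) ++ x) ∎
  where
  open ≤-Reasoning
  lemma : ∀ c q p t → 4 * c * (q * p + q * t) ≡ 4 * q * (c * (p + t))
  lemma = solve-∀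

Ext-cong : ∀ r u v {F G : Word → Word → ℕ} → length u ≡ length v →
  (∀ u v → length u ≡ length v → F u v ≡ G u v) → Ext r u v F ≡ Ext r u v G
Ext-cong zero    u v l h = h u v l
Ext-cong (suc r) u v l h = four-cong λ a b →
  Ext-cong r (u ∷ʳ a) (b ∷ v) (trans (length-∷ʳ u a) (cong suc l)) h

-- The new letters do not affect earlier indices, so one step counts each old gap four times and
-- adds the gaps at the newest index.
Ext-miss-suc : ∀ r u v → length u ≡ length v →
  Ext (suc r) u v miss ≡ 4 * Ext r u v miss + Ext (suc r) u v (λ u v → gap (hit u v))
Ext-miss-suc r u v l = begin
  Ext (suc r) u v miss
    ≡⟨ Ext-last r u v miss ⟩
  Ext r u v (λ u v → four (λ a b → miss (u ∷ʳ a) (b ∷ v)))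
    ≡⟨ Ext-cong r u v l (λ u v e → trans (four-cong (λ a b → miss-step u v a b (≤-reflexive (sym e))))
         (trans (four-+ (λ a b → gap (hit (u ∷ʳ a) (b ∷ v))) (λ _ _ → miss u v))
           (trans (+-comm _ (four (λ _ _ → miss u v))) (cong (_+ gaps u v) (four-const (miss u v)))))) ⟩
  Ext r u v (λ u v → 4 * miss u v + gaps u v)
    ≡⟨ Ext-+ r u v (λ u v → 4 * miss u v) gaps ⟩
  Ext r u v (λ u v → 4 * miss u v) + Ext r u v gaps
    ≡⟨ cong₂ _+_ (Ext-* r u v 4 miss) (sym (Ext-last r u v (λ u v → gap (hit u v)))) ⟩
  4 * Ext r u v miss + Ext (suc r) u v (λ u v → gap (hit u v)) ∎
  where
  open ≡-Reasoning
  gaps : Word → Word → ℕ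
  gaps u v = four (λ a b → gap (hit (u ∷ʳ a) (b ∷ v)))

Ext-miss : ∀ r A B → length A ≡ length B → 4 ^ length A * Ext r A (reverse B) miss
  ≡ 4 ^ r * (4 ^ length A * miss A (reverse B)) + ΣΦ r A B
Ext-miss zero    A B l = sym (trans (+-identityʳ _) (+-identityʳ _))
Ext-miss (suc r) A B l = begin
  p * Ext (suc r) A (reverse B) miss
    ≡⟨ cong (p *_) (Ext-miss-suc r A (reverse B) (trans l (sym (length-reverse B)))) ⟩
  p * (4 * Ext r A (reverse B) miss + g)
    ≡⟨ lemma p (Ext r A (reverse B) miss) g ⟩
  4 * (p * Ext r A (reverse B) miss) + p * g
    ≡⟨ cong₂ (λ x y → 4 * x + y) (Ext-miss r A B l) (Ext-gap (suc r) A B l) ⟩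
  4 * (4 ^ r * (p * miss A (reverse B)) + ΣΦ r A B) + Φ (suc r) A B
    ≡⟨ lemma′ (4 ^ r) (p * miss A (reverse B)) (ΣΦ r A B) (Φ (suc r) A B) ⟩
  4 ^ suc r * (p * miss A (reverse B)) + ΣΦ (suc r) A B ∎
  where
  open ≡-Reasoning
  p = 4 ^ length A
  g = Ext (suc r) A (reverse B) (λ u v → gap (hit u v))
  lemma : ∀ p e g → p * (4 * e + g) ≡ 4 * (p * e) + p * g
  lemma = solve-∀
  lemma′ : ∀ q m s t → 4 * (q * m + s) + t ≡ 4 * q * m + (4 * s + t)
  lemma′ = solve-∀

Ext-miss-≤ : ∀ r u v → length u ≡ length v →
  4 ^ length u * Ext r u v miss ≤ 4 ^ r * (4 ^ length u * miss u v + tailBound u (reverse v) v)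
Ext-miss-≤ r u v l = begin
  4 ^ length u * Ext r u v miss
    ≡⟨ cong (λ v → 4 ^ length u * Ext r u v miss) (reverse-involutive v) ⟨
  4 ^ length u * Ext r u (reverse (reverse v)) miss
    ≡⟨ Ext-miss r u (reverse v) l′ ⟩
  4 ^ r * (4 ^ length u * miss u (reverse (reverse v))) + ΣΦ r u (reverse v)
    ≤⟨ +-monoʳ-≤ _ (ΣΦ≤tailBound r u (reverse v) [] l′) ⟩
  4 ^ r * (4 ^ length u * miss u (reverse (reverse v))) + 4 ^ r * tailBound u (reverse v) (reverse (reverse v) ++ [])
    ≡⟨ *-distribˡ-+ (4 ^ r) _ _ ⟨
  4 ^ r * (4 ^ length u * miss u (reverse (reverse v)) + tailBound u (reverse v) (reverse (reverse v) ++ []))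
    ≡⟨ cong₂ (λ x y → 4 ^ r * (4 ^ length u * miss u x + tailBound u (reverse v) y))
         (reverse-involutive v) (trans (++-identityʳ _) (reverse-involutive v)) ⟩
  4 ^ r * (4 ^ length u * miss u v + tailBound u (reverse v) v) ∎
  where
  open ≤-Reasoning
  l′ = trans l (sym (length-reverse v))

-- Certified lower bounds

-- Extending never removes a gap, so the pointwise comparison may assume that at least `m` gaps are
-- present.
Ext-mono : ∀ r u v {F G : Word → Word → ℕ} m → length u ≡ length v → m ≤ miss u v →
  (∀ u v → m ≤ miss u v → F u v ≤ G u v) → Ext r u v F ≤ Ext r u v G
Ext-mono zero    u v m l m≤ h = h u v m≤
Ext-mono (suc r) u v m l m≤ h = four-mono λ a b →
  Ext-mono r (u ∷ʳ a) (b ∷ v) m (trans (length-∷ʳ u a) (cong suc l))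
    (≤-trans m≤ (≤-trans (m≤n+m _ _) (≤-reflexive (sym (miss-step u v a b (≤-reflexive (sym l))))))) h

-- Each further gap costs at most `s`, and the expected number of further gaps is at most
-- `tailBound / 4 ^ length u`. Truncation of the difference is harmless as the right side is a
-- natural number.
leaf-bound : ∀ r u v (G : ℕ → ℕ) g s → length u ≡ length v →
  (∀ k → g ≤ G (miss u v + k) + s * k) →
  (g * 4 ^ length u ∸ s * tailBound u (reverse v) v) * 4 ^ r ≤ 4 ^ length u * Ext r u v (λ u v → G (miss u v))
leaf-bound r u v G g s l h = begin
  (g * p ∸ s * t) * q
    ≡⟨ *-distribʳ-∸ q (g * p) (s * t) ⟩
  g * p * q ∸ s * t * q
    ≤⟨ m≤n+o⇒m∸n≤o (g * p * q) (s * t * q) (+-cancelʳ-≤ (s * (q * (p * m))) _ _ total) ⟩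
  p * Ext r u v G′ ∎
  where
  open ≤-Reasoning
  p = 4 ^ length u
  q = 4 ^ r
  t = tailBound u (reverse v) v
  m = miss u v
  G′ : Word → Word → ℕ
  G′ u v = G (miss u v)
  pointwise : ∀ u′ v′ → m ≤ miss u′ v′ → g + s * m ≤ G′ u′ v′ + s * miss u′ v′
  pointwise u′ v′ m≤ = begin
    g + s * m                                  ≤⟨ +-monoˡ-≤ (s * m) (h k) ⟩
    G (m + k) + s * k + s * m                  ≡⟨ lemma (G (m + k)) s k m ⟩
    G (m + k) + s * (m + k)                    ≡⟨ cong (λ j → G j + s * j) (m+[n∸m]≡n m≤) ⟩
    G′ u′ v′ + s * miss u′ v′                  ∎
    where
    k = miss u′ v′ ∸ m
    lemma : ∀ a s k m → a + s * k + s * m ≡ a + s * (m + k)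
    lemma = solve-∀
  summed : q * (g + s * m) ≤ Ext r u v G′ + s * Ext r u v miss
  summed = begin
    q * (g + s * m)                                ≡⟨ Ext-const r u v (g + s * m) ⟨
    Ext r u v (λ _ _ → g + s * m)                  ≤⟨ Ext-mono r u v m l ≤-refl pointwise ⟩
    Ext r u v (λ u v → G′ u v + s * miss u v)      ≡⟨ Ext-+ r u v G′ (λ u v → s * miss u v) ⟩
    Ext r u v G′ + Ext r u v (λ u v → s * miss u v) ≡⟨ cong (Ext r u v G′ +_) (Ext-* r u v s miss) ⟩
    Ext r u v G′ + s * Ext r u v miss              ∎
  total : g * p * q + s * (q * (p * m)) ≤ s * t * q + p * Ext r u v G′ + s * (q * (p * m))
  total = begin
    g * p * q + s * (q * (p * m))                     ≡⟨ lemma₁ g p q s m ⟩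
    p * (q * (g + s * m))                             ≤⟨ *-monoʳ-≤ p summed ⟩
    p * (Ext r u v G′ + s * Ext r u v miss)           ≡⟨ lemma₂ p (Ext r u v G′) s (Ext r u v miss) ⟩
    p * Ext r u v G′ + s * (p * Ext r u v miss)       ≤⟨ +-monoʳ-≤ (p * Ext r u v G′) (*-monoʳ-≤ s (Ext-miss-≤ r u v l)) ⟩
    p * Ext r u v G′ + s * (q * (p * m + t))          ≡⟨ lemma₃ (p * Ext r u v G′) s q (p * m) t ⟩
    s * t * q + p * Ext r u v G′ + s * (q * (p * m))  ∎
    where
    lemma₁ : ∀ g p q s m → g * p * q + s * (q * (p * m)) ≡ p * (q * (g + s * m))
    lemma₁ = solve-∀
    lemma₂ : ∀ p e s f → p * (e + s * f) ≡ p * e + s * (p * f)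
    lemma₂ = solve-∀
    lemma₃ : ∀ e s q m t → e + s * (q * (m + t)) ≡ s * t * q + e + s * (q * m)
    lemma₃ = solve-∀

-- An entry (g , s , e) of a profile: the function takes the value g here and drops with slope at most s
-- from here on; e weighs the node in the stopping rule and has no influence on correctness.
Profile : Set
Profile = List (ℕ × ℕ × ℕ)

value : ℕ → Profile → ℕ → ℕ
value K []                   k       = K
value K ((g , _ , _) ∷ ps)   zero    = g
value K (_ ∷ ps)             (suc k) = value K ps k

-- `d` is `s` times the distance to the entry under test. Past the end the value stays `K` while the
-- allowance grows, so a single test against `K` suffices.
slopeOK : ℕ → ℕ → ℕ → ℕ → Profile → Bool
slopeOK K g s d []                  = g ≤ᵇ K + d
slopeOK K g s d ((g′ , _ , _) ∷ ps) = (g ≤ᵇ g′ + d) ∧ slopeOK K g s (d + s) ps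

profileOK : ℕ → Profile → Bool
profileOK K []                 = true
profileOK K ((g , s , _) ∷ ps) = slopeOK K g s s ps ∧ profileOK K ps

slope : ∀ K g s d ps → T (slopeOK K g s d ps) → ∀ k → g ≤ value K ps k + (d + s * k)
slope K g s d [] ok k = ≤-trans (≤ᵇ⇒≤ g (K + d) ok) (+-monoʳ-≤ K (m≤m+n d (s * k)))
slope K g s d ((g′ , _ , _) ∷ ps) ok zero =
  ≤-trans (≤ᵇ⇒≤ g (g′ + d) (proj₁ (Equivalence.to T-∧ ok))) (+-monoʳ-≤ g′ (m≤m+n d (s * 0)))
slope K g s d ((g′ , _ , _) ∷ ps) ok (suc k) =
  ≤-trans (slope K g s (d + s) ps (proj₂ (Equivalence.to (T-∧ {g ≤ᵇ g′ + d}) ok)) k)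
    (≤-reflexive (lemma (value K ps k) d s k))
  where
  lemma : ∀ x d s k → x + (d + s + s * k) ≡ x + (d + s * suc k)
  lemma = solve-∀

module _ (K τ : ℕ) where

  -- Results are numerators over `4 ^ length u * 16 ^ f`. A step multiplies the first factor by 4
  -- and divides the second by 16, so the denominator drops by 4 and the mean over four children is
  -- the plain sum of their numerators. A new gap removes the head of the profile; an empty profile
  -- stands for the constant `K` and ends the search exactly.
  lowerBound : ℕ → Word → Word → Profile → ℕ
  branch     : Bool → ℕ → ℕ → Word → Word → ℕ → ℕ → ℕ → Profile → ℕ
  child      : Bool → ℕ → Word → Word → ℕ × ℕ × ℕ → Profile → ℕ

  leaf : ℕ → ℕ → ℕ → ℕ → ℕ → ℕ
  leaf f J g s t = (g * 4 ^ J ∸ s * t) * 16 ^ f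

  lowerBound f       u v []                 = K * 4 ^ length u * 16 ^ f
  lowerBound zero    u v ((g , s , e) ∷ ps) = leaf 0 (length u) g s (tailBound u (reverse v) v)
  -- Since numerators just add up, a leaf here costs the root numerator at most
  -- `s * t * 16 ^ suc f`; the rule tests this with `e` in place of `s`.
  lowerBound (suc f) u v ((g , s , e) ∷ ps) = branch (e * t * 16 ^ suc f <ᵇ τ) f t u v g s e ps
    where t = tailBound u (reverse v) v

  branch true  f t u v g s e ps = leaf (suc f) (length u) g s t
  branch false f t u v g s e ps =
    four (λ a b → child (hit (u ∷ʳ a) (b ∷ v)) f (u ∷ʳ a) (b ∷ v) (g , s , e) ps)

  child true  f u v p ps = lowerBound f u v (p ∷ ps)
  child false f u v p ps = lowerBound f u v ps

  Sound : ℕ → ℕ → Word → Word → (ℕ → ℕ) → ℕ → Set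
  Sound f r u v G x = x * 4 ^ r ≤ 4 ^ length u * 16 ^ f * Ext r u v (λ u v → G (miss u v))

  leaf-sound : ∀ f r u v G g s → length u ≡ length v → (∀ k → g ≤ G (miss u v + k) + s * k) →
    Sound f r u v G (leaf f (length u) g s (tailBound u (reverse v) v))
  leaf-sound f r u v G g s l h = begin
    (g * 4 ^ length u ∸ s * t) * 16 ^ f * 4 ^ r
      ≡⟨ lemma (g * 4 ^ length u ∸ s * t) (16 ^ f) (4 ^ r) ⟩
    (g * 4 ^ length u ∸ s * t) * 4 ^ r * 16 ^ f
      ≤⟨ *-monoˡ-≤ (16 ^ f) (leaf-bound r u v G g s l h) ⟩
    4 ^ length u * E * 16 ^ f
      ≡⟨ lemma (4 ^ length u) E (16 ^ f) ⟩
    4 ^ length u * 16 ^ f * E ∎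
    where
    open ≤-Reasoning
    t = tailBound u (reverse v) v
    E = Ext r u v (λ u v → G (miss u v))
    lemma : ∀ x y z → x * y * z ≡ x * z * y
    lemma = solve-∀

  drop-slope : ∀ u v (G : ℕ → ℕ) g s e ps → T (profileOK K ((g , s , e) ∷ ps)) →
    (∀ k → G (miss u v + k) ≡ value K ((g , s , e) ∷ ps) k) →
    ∀ k → g ≤ G (miss u v + k) + s * k
  drop-slope u v G g s e ps ok eq zero    = ≤-trans (≤-reflexive (sym (eq 0))) (m≤m+n _ _)
  drop-slope u v G g s e ps ok eq (suc k) = begin
    g                             ≤⟨ slope K g s s ps (proj₁ (Equivalence.to T-∧ ok)) k ⟩
    value K ps k + (s + s * k)    ≡⟨ cong₂ _+_ (eq (suc k)) (*-suc s k) ⟨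
    G (miss u v + suc k) + s * suc k ∎
    where open ≤-Reasoning

  -- The remaining profile is `G` seen from the present number of gaps onwards, and `f ≤ r` keeps
  -- the search within the letters summed over.
  lowerBound-sound : ∀ f r u v G ps → length u ≡ length v → f ≤ r → T (profileOK K ps) →
    (∀ k → G (miss u v + k) ≡ value K ps k) → Sound f r u v G (lowerBound f u v ps)
  branch-sound : ∀ d f r u v G g s e ps → length u ≡ length v → f ≤ r →
    T (profileOK K ((g , s , e) ∷ ps)) →
    (∀ k → G (miss u v + k) ≡ value K ((g , s , e) ∷ ps) k) →
    Sound (suc f) (suc r) u v G (branch d f (tailBound u (reverse v) v) u v g s e ps)
  child-sound : ∀ d f r u v G p ps → length u ≡ length v → f ≤ r → T (profileOK K (p ∷ ps)) →
    (∀ k → G (miss u v + k) ≡ value K (p ∷ ps) (gap d + k)) →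
    Sound f r u v G (child d f u v p ps)

  lowerBound-sound f r u v G [] l f≤r ok eq = begin
    K * 4 ^ length u * 16 ^ f * 4 ^ r
      ≡⟨ lemma K (4 ^ length u) (16 ^ f) (4 ^ r) ⟩
    4 ^ length u * 16 ^ f * (4 ^ r * K)
      ≡⟨ cong (4 ^ length u * 16 ^ f *_) (Ext-const r u v K) ⟨
    4 ^ length u * 16 ^ f * Ext r u v (λ _ _ → K)
      ≤⟨ *-monoʳ-≤ (4 ^ length u * 16 ^ f) (Ext-mono r u v (miss u v) l ≤-refl
           λ u′ v′ m≤ → ≤-reflexive (trans (sym (eq _)) (cong G (m+[n∸m]≡n m≤)))) ⟩
    4 ^ length u * 16 ^ f * Ext r u v (λ u v → G (miss u v)) ∎
    where
    open ≤-Reasoning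
    lemma : ∀ k p x q → k * p * x * q ≡ p * x * (q * k)
    lemma = solve-∀
  lowerBound-sound zero r u v G ((g , s , e) ∷ ps) l f≤r ok eq =
    leaf-sound zero r u v G g s l (drop-slope u v G g s e ps ok eq)
  lowerBound-sound (suc f) (suc r) u v G ((g , s , e) ∷ ps) l (s≤s f≤r) ok eq =
    branch-sound (e * tailBound u (reverse v) v * 16 ^ suc f <ᵇ τ) f r u v G g s e ps l f≤r ok eq

  branch-sound true  f r u v G g s e ps l f≤r ok eq =
    leaf-sound (suc f) (suc r) u v G g s l (drop-slope u v G g s e ps ok eq)
  branch-sound false f r u v G g s e ps l f≤r ok eq = begin
    four c * (4 * 4 ^ r)
      ≡⟨ lemma₁ (four c) (4 ^ r) ⟩
    4 * (4 ^ r * four c)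
      ≡⟨ cong (4 *_) (four-* (4 ^ r) c) ⟨
    4 * four (λ a b → 4 ^ r * c a b)
      ≤⟨ *-monoʳ-≤ 4 (four-mono step) ⟩
    4 * four (λ a b → 4 * 4 ^ length u * 16 ^ f * E a b)
      ≡⟨ cong (4 *_) (four-* (4 * 4 ^ length u * 16 ^ f) E) ⟩
    4 * (4 * 4 ^ length u * 16 ^ f * four E)
      ≡⟨ lemma₂ (4 ^ length u) (16 ^ f) (four E) ⟩
    4 ^ length u * (16 * 16 ^ f) * four E ∎
    where
    open ≤-Reasoning
    c : Bool → Bool → ℕ
    c a b = child (hit (u ∷ʳ a) (b ∷ v)) f (u ∷ʳ a) (b ∷ v) (g , s , e) ps
    E : Bool → Bool → ℕ
    E a b = Ext r (u ∷ʳ a) (b ∷ v) (λ u v → G (miss u v))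
    lemma₁ : ∀ x q → x * (4 * q) ≡ 4 * (q * x)
    lemma₁ = solve-∀
    lemma₂ : ∀ p x y → 4 * (4 * p * x * y) ≡ p * (16 * x) * y
    lemma₂ = solve-∀
    shift : ∀ a b k → G (miss (u ∷ʳ a) (b ∷ v) + k) ≡ value K ((g , s , e) ∷ ps) (gap (hit (u ∷ʳ a) (b ∷ v)) + k)
    shift a b k = trans (cong G (trans (cong (_+ k) (miss-step u v a b (≤-reflexive (sym l))))
      (lemma₃ (gap (hit (u ∷ʳ a) (b ∷ v))) (miss u v) k))) (eq _)
      where
      lemma₃ : ∀ x m k → x + m + k ≡ m + (x + k)
      lemma₃ = solve-∀
    step : ∀ a b → 4 ^ r * c a b ≤ 4 * 4 ^ length u * 16 ^ f * E a b
    step a b = begin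
      4 ^ r * c a b ≡⟨ *-comm (4 ^ r) (c a b) ⟩
      c a b * 4 ^ r ≤⟨ child-sound (hit (u ∷ʳ a) (b ∷ v)) f r (u ∷ʳ a) (b ∷ v) G (g , s , e) ps
                         (trans (length-∷ʳ u a) (cong suc l)) f≤r ok (shift a b) ⟩
      4 ^ length (u ∷ʳ a) * 16 ^ f * E a b
        ≡⟨ cong (λ n → 4 ^ n * 16 ^ f * E a b) (length-∷ʳ u a) ⟩
      4 * 4 ^ length u * 16 ^ f * E a b ∎

  child-sound true  f r u v G p ps l f≤r ok eq = lowerBound-sound f r u v G (p ∷ ps) l f≤r ok eq
  child-sound false f r u v G p@(g , s , _) ps l f≤r ok eq =
    lowerBound-sound f r u v G ps l f≤r (proj₂ (Equivalence.to (T-∧ {slopeOK K g s s ps}) ok)) eq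

-- Removing leading zeros

δ : ℕ → ℕ → ℕ
δ zero    zero    = 1
δ zero    (suc n) = 0
δ (suc m) zero    = 0
δ (suc m) (suc n) = δ m n

δ≤1 : ∀ m n → δ m n ≤ 1
δ≤1 zero    zero    = ≤-refl
δ≤1 zero    (suc n) = z≤n
δ≤1 (suc m) zero    = z≤n
δ≤1 (suc m) (suc n) = δ≤1 m n

X : ℕ → (ℕ → ℕ) → ℕ
X h g = sumW h (λ u → sumW h (λ v → g (miss u v)))

X-cong : ∀ h {f g : ℕ → ℕ} → (∀ m → f m ≡ g m) → X h f ≡ X h g
X-cong h eq = sumW-cong h λ u _ → sumW-cong h λ v _ → eq (miss u v)

X-+ : ∀ h f g → X h (λ m → f m + g m) ≡ X h f + X h g
X-+ h f g = trans (sumW-cong h λ u _ → sumW-+ h (f ∘ miss u) (g ∘ miss u)) (sumW-+ h _ _)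

X-* : ∀ h c f → X h (λ m → c * f m) ≡ c * X h f
X-* h c f = trans (sumW-cong h λ u _ → sumW-* h c (f ∘ miss u)) (sumW-* h c _)

X-Ext : ∀ h g → X h g ≡ Ext h [] [] (λ u v → g (miss u v))
X-Ext h g = sym (trans (Ext-sumW h [] [] _)
  (sumW-cong h λ u _ → sumW-cong h λ v _ → cong (g ∘ miss u) (++-identityʳ v)))

X-const : ∀ h c → X h (λ _ → c) ≡ 4 ^ h * c
X-const h c = trans (X-Ext h (λ _ → c)) (Ext-const h [] [] c)

-- Removing a leading zero of A or of B shifts A + B by one and so removes one missing sum.
miss-false∷ : ∀ u b v → miss (false ∷ u) (b ∷ v) ≡ suc (miss u v)
miss-false∷ u b []       = cong (λ h → gap h + 0) (hit-[] u)
miss-false∷ u b (b′ ∷ v) = trans (cong (gap (hit u (b′ ∷ v)) +_) (miss-false∷ u b′ v)) (+-suc _ _)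

hit-∷ʳfalse : ∀ u v → hit u (v ∷ʳ false) ≡ hit u v
hit-∷ʳfalse []          v           = refl
hit-∷ʳfalse (true  ∷ u) []          = trans (hit-[] u) (sym (hit-[] (true ∷ u)))
hit-∷ʳfalse (false ∷ u) []          = trans (hit-[] u) (sym (hit-[] (false ∷ u)))
hit-∷ʳfalse (true  ∷ u) (true  ∷ v) = refl
hit-∷ʳfalse (true  ∷ u) (false ∷ v) = hit-∷ʳfalse u v
hit-∷ʳfalse (false ∷ u) (b ∷ v)     = hit-∷ʳfalse u v

miss-∷ʳfalse : ∀ u v → miss u (v ∷ʳ false) ≡ suc (miss u v)
miss-∷ʳfalse u []      = cong (λ h → gap h + 0) (trans (hit-∷ʳfalse u []) (hit-[] u))
miss-∷ʳfalse u (b ∷ v) =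
  trans (cong₂ _+_ (cong gap (hit-∷ʳfalse u (b ∷ v))) (miss-∷ʳfalse u v)) (+-suc _ _)

-- X sums over all pairs (A , B), Y over those with 0 ∈ A, Z over those with 0 ∈ A and 0 ∈ B.
Y : ℕ → (ℕ → ℕ) → ℕ
Y h g = sumW h (λ u → sumW (suc h) (λ v → g (miss (true ∷ u) v)))

Z : ℕ → (ℕ → ℕ) → ℕ
Z h g = Ext h (true ∷ []) (true ∷ []) (λ u v → g (miss u v))

double : ∀ n (F : Word → ℕ) → sumW n F + sumW n F ≡ 2 * sumW n F
double n F = cong (sumW n F +_) (sym (+-identityʳ _))

-- If 0 ∉ A, the last letter of B, which is the head of `v`, takes part in no sum below the length;
-- it is free and gives the factor 2. `Y-suc` is the same with the roles of A and B exchanged.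
X-suc : ∀ h g → X (suc h) g ≡ 2 * X h (g ∘ suc) + Y h g
X-suc h g = cong (_+ Y h g) (trans
  (sumW-cong h λ u _ → trans
    (cong₂ _+_ (sumW-cong h λ v _ → cong g (miss-false∷ u false v))
               (sumW-cong h λ v _ → cong g (miss-false∷ u true v)))
    (double h (λ v → g (suc (miss u v)))))
  (sumW-* h 2 (λ u → sumW h (λ v → g (suc (miss u v))))))

Y-suc : ∀ h g → Y (suc h) g ≡ 2 * Y h (g ∘ suc) + Z (suc h) g
Y-suc h g = begin
  sumW (suc h) (λ u → sumW (suc (suc h)) (λ v → g (miss (true ∷ u) v)))
    ≡⟨ sumW-cong (suc h) (λ u _ → sumW-∷ʳ (suc h) (λ v → g (miss (true ∷ u) v))) ⟩
  sumW (suc h) (λ u → Fₗ u + Fᵣ u)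
    ≡⟨ sumW-+ (suc h) Fₗ Fᵣ ⟩
  sumW (suc h) Fₗ + sumW (suc h) Fᵣ
    ≡⟨ cong₂ _+_ left (sym (Ext-sumW (suc h) (true ∷ []) (true ∷ []) (λ u v → g (miss u v)))) ⟩
  2 * Y h (g ∘ suc) + Z (suc h) g ∎
  where
  open ≡-Reasoning
  Fₗ Fᵣ : Word → ℕ
  Fₗ u = sumW (suc h) (λ v → g (miss (true ∷ u) (v ∷ʳ false)))
  Fᵣ u = sumW (suc h) (λ v → g (miss (true ∷ u) (v ∷ʳ true)))
  last-free : ∀ a u → length u ≡ h → Fₗ (u ∷ʳ a) ≡ sumW (suc h) (λ v → g (suc (miss (true ∷ u) v)))
  last-free a u l = sumW-cong (suc h) λ v l′ → cong g (trans (miss-∷ʳfalse (true ∷ u ∷ʳ a) v)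
    (cong suc (miss-++ˡ (true ∷ u) (a ∷ []) v (≤-reflexive (trans l′ (cong suc (sym l)))))))
  left : sumW (suc h) Fₗ ≡ 2 * Y h (g ∘ suc)
  left = trans (sumW-∷ʳ h Fₗ)
    (trans (cong₂ _+_ (sumW-cong h (last-free false)) (sumW-cong h (last-free true))) (double h _))

-- `Y` is eliminated between two uses of `X-suc` and one of `Y-suc`. After division by `4 ^ (2 + h)`
-- this is the operator (1 - S/2)², where S is the shift `g ↦ g ∘ suc`.
Z-X : ∀ h g → Z (suc h) g + 4 * X (suc h) (g ∘ suc) ≡ X (suc (suc h)) g + 4 * X h (g ∘ suc ∘ suc)
Z-X h g = begin
  z + 4 * x₁                            ≡⟨ cong (λ x → z + 4 * x) (X-suc h (g ∘ suc)) ⟩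
  z + 4 * (2 * x₀ + y₀)                 ≡⟨ lemma z x₀ y₀ ⟩
  2 * (2 * x₀ + y₀) + (2 * y₀ + z) + 4 * x₀
    ≡⟨ cong₂ (λ x y → 2 * x + y + 4 * x₀) (X-suc h (g ∘ suc)) (Y-suc h g) ⟨
  2 * x₁ + Y (suc h) g + 4 * x₀         ≡⟨ cong (_+ 4 * x₀) (X-suc (suc h) g) ⟨
  X (suc (suc h)) g + 4 * x₀            ∎
  where
  open ≡-Reasoning
  z = Z (suc h) g
  x₁ = X (suc h) (g ∘ suc)
  x₀ = X h (g ∘ suc ∘ suc)
  y₀ = Y h (g ∘ suc)
  lemma : ∀ z x y → z + 4 * (2 * x + y) ≡ 2 * (2 * x + y) + (2 * y + z) + 4 * x
  lemma = solve-∀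

-- Convergence of the gap distribution

gaps : Word → Word → ℕ
gaps u v = four (λ a b → gap (hit (u ∷ʳ a) (b ∷ v)))

Ext-gaps : ∀ h → Ext h [] [] gaps ≡ 3 ^ suc h
Ext-gaps h = trans (sym (Ext-last h [] [] (λ u v → gap (hit u v))))
  (trans (sym (*-identityˡ _)) (trans (Ext-gap (suc h) [] [] refl) (Φ-[] (suc h))))

X-last : ∀ h f → X (suc h) f ≡ Ext h [] [] (λ u v → four (λ a b → f (gap (hit (u ∷ʳ a) (b ∷ v)) + miss u v)))
X-last h f = trans (X-Ext (suc h) f) (trans (Ext-last h [] [] _)
  (Ext-cong h [] [] refl λ u v l → four-cong λ a b → cong f (miss-step u v a b (≤-reflexive (sym l)))))

Ext-four-gap : ∀ h f C → Ext h [] [] (λ u v → 4 * f (miss u v) + C * gaps u v) ≡ 4 * X h f + C * 3 ^ suc h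
Ext-four-gap h f C = trans (Ext-+ h [] [] _ _)
  (cong₂ _+_ (trans (Ext-* h [] [] 4 _) (cong (4 *_) (sym (X-Ext h f))))
             (trans (Ext-* h [] [] C gaps) (cong (C *_) (Ext-gaps h))))

module _ (f : ℕ → ℕ) (C : ℕ) (f≤C : ∀ m → f m ≤ C) where

  gap-≤ : ∀ d m → f (gap d + m) ≤ f m + C * gap d
  gap-≤ true  m = m≤m+n (f m) _
  gap-≤ false m = ≤-trans (≤-trans (f≤C (suc m)) (≤-reflexive (sym (*-identityʳ C)))) (m≤n+m _ (f m))

  gap-≥ : ∀ d m → f m ≤ f (gap d + m) + C * gap d
  gap-≥ true  m = m≤m+n (f m) _
  gap-≥ false m = ≤-trans (≤-trans (f≤C m) (≤-reflexive (sym (*-identityʳ C)))) (m≤n+m _ (f (suc m)))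

  -- The newest index changes `miss` only when it is a gap, which happens for `3 ^ suc h` pairs of
  -- words, and there `f` moves by at most `C`.
  X-suc-≤ : ∀ h → X (suc h) f ≤ 4 * X h f + C * 3 ^ suc h
  X-suc-≤ h = begin
    X (suc h) f
      ≡⟨ X-last h f ⟩
    Ext h [] [] (λ u v → four (λ a b → f (gap (hit (u ∷ʳ a) (b ∷ v)) + miss u v)))
      ≤⟨ Ext-mono h [] [] 0 refl z≤n (λ u v _ → ≤-trans
           (four-mono λ a b → gap-≤ (hit (u ∷ʳ a) (b ∷ v)) (miss u v))
           (≤-reflexive (trans (four-+ (λ _ _ → f (miss u v)) (λ a b → C * gap (hit (u ∷ʳ a) (b ∷ v))))
             (cong₂ _+_ (four-const (f (miss u v))) (four-* C (λ a b → gap (hit (u ∷ʳ a) (b ∷ v)))))))) ⟩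
    Ext h [] [] (λ u v → 4 * f (miss u v) + C * gaps u v)
      ≡⟨ Ext-four-gap h f C ⟩
    4 * X h f + C * 3 ^ suc h ∎
    where open ≤-Reasoning

  X-suc-≥ : ∀ h → 4 * X h f ≤ X (suc h) f + C * 3 ^ suc h
  X-suc-≥ h = begin
    4 * X h f
      ≡⟨ cong (4 *_) (X-Ext h f) ⟩
    4 * Ext h [] [] (λ u v → f (miss u v))
      ≡⟨ Ext-* h [] [] 4 (λ u v → f (miss u v)) ⟨
    Ext h [] [] (λ u v → 4 * f (miss u v))
      ≤⟨ Ext-mono h [] [] 0 refl z≤n (λ u v _ → ≤-trans
           (≤-reflexive (sym (four-const (f (miss u v)))))
           (≤-trans (four-mono λ a b → gap-≥ (hit (u ∷ʳ a) (b ∷ v)) (miss u v))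
             (≤-reflexive (trans (four-+ (F u v) (λ a b → C * gap (hit (u ∷ʳ a) (b ∷ v))))
               (cong (four (F u v) +_) (four-* C (λ a b → gap (hit (u ∷ʳ a) (b ∷ v))))))))) ⟩
    Ext h [] [] (λ u v → four (F u v) + C * gaps u v)
      ≡⟨ Ext-+ h [] [] (λ u v → four (F u v)) (λ u v → C * gaps u v) ⟩
    Ext h [] [] (λ u v → four (F u v)) + Ext h [] [] (λ u v → C * gaps u v)
      ≡⟨ cong₂ _+_ (sym (X-last h f)) (trans (Ext-* h [] [] C gaps) (cong (C *_) (Ext-gaps h))) ⟩
    X (suc h) f + C * 3 ^ suc h ∎
    where
    open ≤-Reasoning
    F : Word → Word → Bool → Bool → ℕ
    F u v a b = f (gap (hit (u ∷ʳ a) (b ∷ v)) + miss u v)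

  -- `3 * (C * 3 ^ h)` is the sum of all later errors, since the sum of (3/4)^i over i ≥ 1 is 3.
  -- With it added, the mean per pair is nonincreasing in the length.
  X-+-≤ : ∀ k h → X (k + h) f + 3 * (C * 3 ^ (k + h)) ≤ 4 ^ k * (X h f + 3 * (C * 3 ^ h))
  X-+-≤ zero    h = ≤-reflexive (sym (+-identityʳ _))
  X-+-≤ (suc k) h = begin
    X (suc (k + h)) f + 3 * (C * (3 * t))          ≤⟨ +-monoˡ-≤ _ (X-suc-≤ (k + h)) ⟩
    4 * X (k + h) f + C * (3 * t) + 3 * (C * (3 * t)) ≡⟨ lemma (X (k + h) f) C t ⟩
    4 * (X (k + h) f + 3 * (C * t))                ≤⟨ *-monoʳ-≤ 4 (X-+-≤ k h) ⟩
    4 * (4 ^ k * (X h f + 3 * (C * 3 ^ h)))        ≡⟨ *-assoc 4 (4 ^ k) _ ⟨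
    4 ^ suc k * (X h f + 3 * (C * 3 ^ h))          ∎
    where
    open ≤-Reasoning
    t = 3 ^ (k + h)
    lemma : ∀ x c t → 4 * x + c * (3 * t) + 3 * (c * (3 * t)) ≡ 4 * (x + 3 * (c * t))
    lemma = solve-∀

  X-+-≥ : ∀ k h → 4 ^ k * X h f + 3 * (C * 3 ^ (k + h)) ≤ X (k + h) f + 4 ^ k * (3 * (C * 3 ^ h))
  X-+-≥ zero    h = ≤-reflexive (cong₂ _+_ (+-identityʳ (X h f)) (sym (+-identityʳ (3 * (C * 3 ^ h)))))
  X-+-≥ (suc k) h = +-cancelʳ-≤ (C * (3 * t)) _ _ (begin
    4 * 4 ^ k * X h f + 3 * (C * (3 * t)) + C * (3 * t)
      ≡⟨ lemma (4 ^ k) (X h f) C t ⟩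
    4 * (4 ^ k * X h f + 3 * (C * t))
      ≤⟨ *-monoʳ-≤ 4 (X-+-≥ k h) ⟩
    4 * (X (k + h) f + 4 ^ k * (3 * (C * 3 ^ h)))
      ≡⟨ lemma′ (X (k + h) f) (4 ^ k) (3 * (C * 3 ^ h)) ⟩
    4 * X (k + h) f + 4 * 4 ^ k * (3 * (C * 3 ^ h))
      ≤⟨ +-monoˡ-≤ _ (X-suc-≥ (k + h)) ⟩
    X (suc (k + h)) f + C * (3 * t) + 4 * 4 ^ k * (3 * (C * 3 ^ h))
      ≡⟨ lemma″ (X (suc (k + h)) f) (C * (3 * t)) (4 * 4 ^ k * (3 * (C * 3 ^ h))) ⟩
    X (suc (k + h)) f + 4 * 4 ^ k * (3 * (C * 3 ^ h)) + C * (3 * t) ∎)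
    where
    open ≤-Reasoning
    t = 3 ^ (k + h)
    lemma : ∀ q x c t → 4 * q * x + 3 * (c * (3 * t)) + c * (3 * t) ≡ 4 * (q * x + 3 * (c * t))
    lemma = solve-∀
    lemma′ : ∀ x q c → 4 * (x + q * c) ≡ 4 * x + 4 * q * c
    lemma′ = solve-∀
    lemma″ : ∀ x y z → x + y + z ≡ x + z + y
    lemma″ = solve-∀

-- From conditioned means to strict inequalities

maxValue : ℕ → Profile → ℕ
maxValue K []                 = K
maxValue K ((g , _ , _) ∷ ps) = g ⊔ maxValue K ps

value≤max : ∀ K ps m → value K ps m ≤ maxValue K ps
value≤max K []                 m       = ≤-refl
value≤max K ((g , _ , _) ∷ ps) zero    = m≤m⊔n g _
value≤max K ((g , _ , _) ∷ ps) (suc m) = ≤-trans (value≤max K ps m) (m≤n⊔m g _)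

-- By Z-X, the shape condition turns the excess of the mean of g over K on pairs with 0 ∈ A and 0 ∈ B into
-- 64 times the difference between the probabilities of b and of a missing sums, up to O((3/4)^h).
module Comparison
  (a b K τ fuel : ℕ) (ps : Profile)
  (ok : T (profileOK K ps))
  (shape : ∀ m → 4 * value K ps m + value K ps (suc (suc m)) + 64 * δ a m
               ≡ 4 * value K ps (suc m) + K + 64 * δ b m)
  (cert : K * (4 * 16 ^ fuel) < lowerBound K τ fuel (true ∷ []) (true ∷ []) ps)
  where

  g : ℕ → ℕ
  g = value K ps

  -- The denominator at the root of the search, where both words have length one.
  M : ℕ
  M = 4 * 16 ^ fuel

  C : ℕ
  C = maxValue K ps

  -- A strict inequality of naturals leaves a surplus of 1; this surplus is the source of the term
  -- `4 ^ (2 + h)` in `X-less`, hence of the gap between the limits.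
  Z-bound : ∀ r → fuel ≤ r → (K * M + 1) * 4 ^ r ≤ M * Z r g
  Z-bound r f≤r = ≤-trans
    (*-monoˡ-≤ (4 ^ r) (≤-trans (≤-reflexive (+-comm (K * M) 1)) cert))
    (lowerBound-sound K τ fuel r (true ∷ []) (true ∷ []) g ps refl f≤r ok (λ _ → refl))

  shape-sum : ∀ h → 4 * X h g + X h (g ∘ suc ∘ suc) + 64 * X h (δ a)
                  ≡ 4 * X h (g ∘ suc) + 4 ^ h * K + 64 * X h (δ b)
  shape-sum h = begin
    4 * X h g + X h (g ∘ suc ∘ suc) + 64 * X h (δ a)
      ≡⟨ cong₂ _+_ (cong (_+ X h (g ∘ suc ∘ suc)) (X-* h 4 g)) (X-* h 64 (δ a)) ⟨
    X h (λ m → 4 * g m) + X h (g ∘ suc ∘ suc) + X h (λ m → 64 * δ a m)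
      ≡⟨ trans (X-+ h (λ m → 4 * g m + g (suc (suc m))) (λ m → 64 * δ a m))
           (cong (_+ X h (λ m → 64 * δ a m)) (X-+ h (λ m → 4 * g m) (g ∘ suc ∘ suc))) ⟨
    X h (λ m → 4 * g m + g (suc (suc m)) + 64 * δ a m)
      ≡⟨ X-cong h shape ⟩
    X h (λ m → 4 * g (suc m) + K + 64 * δ b m)
      ≡⟨ trans (X-+ h (λ m → 4 * g (suc m) + K) (λ m → 64 * δ b m))
           (cong (_+ X h (λ m → 64 * δ b m)) (X-+ h (λ m → 4 * g (suc m)) (λ _ → K))) ⟩
    X h (λ m → 4 * g (suc m)) + X h (λ _ → K) + X h (λ m → 64 * δ b m)
      ≡⟨ cong₂ _+_ (cong₂ _+_ (X-* h 4 (g ∘ suc)) (X-const h K)) (X-* h 64 (δ b)) ⟩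
    4 * X h (g ∘ suc) + 4 ^ h * K + 64 * X h (δ b) ∎
    where open ≡-Reasoning

  -- `Z-X` involves lengths h, h + 1 and h + 2, whereas the shape condition is summed at length h +
  -- 2 only. The three steps below bring the lengths together at a cost of order `3 ^ h`; the terms
  -- cancelled at the outset are the ones that this alignment produces on both sides.
  Z-upper : ∀ h → 64 * X (2 + h) (δ a) + 4 * Z (suc h) g
    ≤ 64 * X (2 + h) (δ b) + 4 ^ (2 + h) * K + 7 * (C * 3 ^ (2 + h))
  Z-upper h = +-cancelʳ-≤ (4 * X (2 + h) (g ∘ suc) + 16 * X (suc h) (g ∘ suc)
                           + 4 * X (suc h) (g ∘ suc ∘ suc) + X (2 + h) (g ∘ suc ∘ suc)) _ _ (begin
    64 * xa + 4 * z + (4 * p₂ + 16 * p₁ + 4 * q₁ + q₂)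
      ≡⟨ l₁ xa z p₂ p₁ q₁ q₂ ⟩
    64 * xa + 4 * (z + 4 * p₁) + 4 * p₂ + 4 * q₁ + q₂
      ≡⟨ cong (λ x → 64 * xa + 4 * x + 4 * p₂ + 4 * q₁ + q₂) (Z-X h g) ⟩
    64 * xa + 4 * (x₂ + 4 * q₀) + 4 * p₂ + 4 * q₁ + q₂
      ≡⟨ l₂ xa x₂ q₀ p₂ q₁ q₂ ⟩
    (4 * x₂ + q₂ + 64 * xa) + 4 * p₂ + 4 * (4 * q₀) + 4 * q₁
      ≡⟨ cong (λ x → x + 4 * p₂ + 4 * (4 * q₀) + 4 * q₁) (shape-sum (2 + h)) ⟩
    (4 * p₂ + k + 64 * xb) + 4 * p₂ + 4 * (4 * q₀) + 4 * q₁
      ≤⟨ +-mono-≤ (+-mono-≤ (+-monoʳ-≤ (4 * p₂ + k + 64 * xb) (*-monoʳ-≤ 4 stepP)) (*-monoʳ-≤ 4 stepQ₀)) stepQ₁ ⟩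
    (4 * p₂ + k + 64 * xb) + 4 * (4 * p₁ + C * (3 * (3 * t))) + 4 * (q₁ + C * (3 * t)) + (q₂ + C * (3 * (3 * t)))
      -- The errors add up to (36 + 12 + 9) C t = 57 C t, rounded up to 63 C t = 7 · 9 C t.
      ≤⟨ m≤m+n _ (6 * (C * t)) ⟩
    (4 * p₂ + k + 64 * xb) + 4 * (4 * p₁ + C * (3 * (3 * t))) + 4 * (q₁ + C * (3 * t)) + (q₂ + C * (3 * (3 * t)))
      + 6 * (C * t)
      ≡⟨ l₃ p₂ k xb p₁ C t q₁ q₂ ⟩
    64 * xb + k + 7 * (C * (3 * (3 * t))) + (4 * p₂ + 16 * p₁ + 4 * q₁ + q₂) ∎)
    where
    open ≤-Reasoning
    xa = X (2 + h) (δ a)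
    xb = X (2 + h) (δ b)
    z  = Z (suc h) g
    x₂ = X (2 + h) g
    p₁ = X (suc h) (g ∘ suc)
    p₂ = X (2 + h) (g ∘ suc)
    q₀ = X h (g ∘ suc ∘ suc)
    q₁ = X (suc h) (g ∘ suc ∘ suc)
    q₂ = X (2 + h) (g ∘ suc ∘ suc)
    k  = 4 ^ (2 + h) * K
    t  = 3 ^ h
    stepP : p₂ ≤ 4 * p₁ + C * (3 * (3 * t))
    stepP = X-suc-≤ (g ∘ suc) C (value≤max K ps ∘ suc) (suc h)
    stepQ₀ : 4 * q₀ ≤ q₁ + C * (3 * t)
    stepQ₀ = X-suc-≥ (g ∘ suc ∘ suc) C (value≤max K ps ∘ suc ∘ suc) h
    stepQ₁ : 4 * q₁ ≤ q₂ + C * (3 * (3 * t))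
    stepQ₁ = X-suc-≥ (g ∘ suc ∘ suc) C (value≤max K ps ∘ suc ∘ suc) (suc h)
    l₁ : ∀ xa z p₂ p₁ q₁ q₂ → 64 * xa + 4 * z + (4 * p₂ + 16 * p₁ + 4 * q₁ + q₂)
       ≡ 64 * xa + 4 * (z + 4 * p₁) + 4 * p₂ + 4 * q₁ + q₂
    l₁ = solve-∀
    l₂ : ∀ xa x₂ q₀ p₂ q₁ q₂ → 64 * xa + 4 * (x₂ + 4 * q₀) + 4 * p₂ + 4 * q₁ + q₂
       ≡ (4 * x₂ + q₂ + 64 * xa) + 4 * p₂ + 4 * (4 * q₀) + 4 * q₁
    l₂ = solve-∀
    l₃ : ∀ p₂ k xb p₁ c t q₁ q₂ →
         (4 * p₂ + k + 64 * xb) + 4 * (4 * p₁ + c * (3 * (3 * t))) + 4 * (q₁ + c * (3 * t)) + (q₂ + c * (3 * (3 * t)))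
         + 6 * (c * t)
       ≡ 64 * xb + k + 7 * (c * (3 * (3 * t))) + (4 * p₂ + 16 * p₁ + 4 * q₁ + q₂)
    l₃ = solve-∀

  X-less : ∀ h → fuel ≤ suc h →
    64 * M * X (2 + h) (δ a) + 4 ^ (2 + h) ≤ 64 * M * X (2 + h) (δ b) + 7 * C * M * 3 ^ (2 + h)
  X-less h f≤ = +-cancelʳ-≤ (K * M * 4 ^ (2 + h)) _ _ (begin
    64 * M * xa + 4 * 4 ^ suc h + K * M * (4 * 4 ^ suc h)
      ≡⟨ l₁ M xa K (4 ^ suc h) ⟩
    M * (64 * xa) + 4 * ((K * M + 1) * 4 ^ suc h)
      ≤⟨ +-monoʳ-≤ (M * (64 * xa)) (*-monoʳ-≤ 4 (Z-bound (suc h) f≤)) ⟩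
    M * (64 * xa) + 4 * (M * Z (suc h) g)
      ≡⟨ l₂ M (64 * xa) (Z (suc h) g) ⟩
    M * (64 * xa + 4 * Z (suc h) g)
      ≤⟨ *-monoʳ-≤ M (Z-upper h) ⟩
    M * (64 * xb + 4 ^ (2 + h) * K + 7 * (C * 3 ^ (2 + h)))
      ≡⟨ l₃ M xb (4 ^ (2 + h)) K C (3 ^ (2 + h)) ⟩
    64 * M * xb + 7 * C * M * 3 ^ (2 + h) + K * M * 4 ^ (2 + h) ∎)
    where
    open ≤-Reasoning
    xa = X (2 + h) (δ a)
    xb = X (2 + h) (δ b)
    l₁ : ∀ m x k q → 64 * m * x + 4 * q + k * m * (4 * q) ≡ m * (64 * x) + 4 * ((k * m + 1) * q)
    l₁ = solve-∀
    l₂ : ∀ m x z → m * x + 4 * (m * z) ≡ m * (x + 4 * z)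
    l₂ = solve-∀
    l₃ : ∀ m x q k c t → m * (64 * x + q * k + 7 * (c * t)) ≡ 64 * m * x + 7 * c * m * t + k * m * q
    l₃ = solve-∀

-- From subsets to words

Σr : ℕ → (ℕ → ℕ) → ℕ
Σr zero    f = 0
Σr (suc n) f = f 0 + Σr n (f ∘ suc)

Σr-cong : ∀ n {f g : ℕ → ℕ} → (∀ i → i < n → f i ≡ g i) → Σr n f ≡ Σr n g
Σr-cong zero    h = refl
Σr-cong (suc n) h = cong₂ _+_ (h 0 z<s) (Σr-cong n λ i i<n → h (suc i) (s<s i<n))

Σr-++ : ∀ m n (f : ℕ → ℕ) → Σr (m + n) f ≡ Σr m f + Σr n (λ i → f (m + i))
Σr-++ zero    n f = refl
Σr-++ (suc m) n f = trans (cong (f 0 +_) (Σr-++ m n (f ∘ suc))) (sym (+-assoc (f 0) _ _))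

Σr-last : ∀ n (f : ℕ → ℕ) → Σr (suc n) f ≡ Σr n f + f n
Σr-last zero    f = +-identityʳ (f 0)
Σr-last (suc n) f = trans (cong (f 0 +_) (Σr-last n (f ∘ suc))) (sym (+-assoc (f 0) _ _))

Σr-reverse : ∀ k (f : ℕ → ℕ) → Σr k (λ i → f (k ∸ i)) ≡ Σr k (f ∘ suc)
Σr-reverse zero    f = refl
Σr-reverse (suc k) f = trans (cong (f (suc k) +_) (Σr-reverse k f))
  (trans (+-comm (f (suc k)) (Σr k (f ∘ suc))) (sym (Σr-last k (f ∘ suc))))

miss-Σr : ∀ u v → miss u v ≡ Σr (length v) (λ d → gap (hit u (drop d v)))
miss-Σr u []      = refl
miss-Σr u (b ∷ v) = cong (gap (hit u (b ∷ v)) +_) (miss-Σr u v)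

at : Word → ℕ → Bool
at []      i       = false
at (a ∷ l) zero    = a
at (a ∷ l) (suc i) = at l i

at-drop : ∀ d l i → at (drop d l) i ≡ at l (d + i)
at-drop zero    l       i = refl
at-drop (suc d) []      i = refl
at-drop (suc d) (a ∷ l) i = at-drop d l i

hit⇒at : ∀ u v → hit u v ≡ true → ∃ λ i → at u i ≡ true × at v i ≡ true
hit⇒at (true ∷ u)  (true ∷ v)  h = 0 , refl , refl
hit⇒at (true ∷ u)  (false ∷ v) h = let i , p , q = hit⇒at u v h in suc i , p , q
hit⇒at (false ∷ u) (b ∷ v)     h = let i , p , q = hit⇒at u v h in suc i , p , q
hit⇒at []          v           ()
hit⇒at (true ∷ u)  []          ()
hit⇒at (false ∷ u) []          ()

at⇒hit : ∀ u v i → at u i ≡ true → at v i ≡ true → hit u v ≡ true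
at⇒hit (true ∷ u)  (true ∷ v)  i       p q = refl
at⇒hit (true ∷ u)  (false ∷ v) (suc i) p q = at⇒hit u v i p q
at⇒hit (false ∷ u) (b ∷ v)     (suc i) p q = at⇒hit u v i p q
at⇒hit (true ∷ u)  (false ∷ v) zero    p ()
at⇒hit (false ∷ u) (b ∷ v)     zero    () q
at⇒hit []          v           i       () q
at⇒hit (a ∷ u)     []          i       p ()

∈⇒at : ∀ {n} {S : Subset n} {x} → x ∈ S → at (toList S) (toℕ x) ≡ true
∈⇒at here      = refl
∈⇒at (there p) = ∈⇒at p

at⇒∈ : ∀ {n} (S : Subset n) i → at (toList S) i ≡ true → ∃ λ x → toℕ x ≡ i × x ∈ S
at⇒∈ (true Vec.∷ S) zero    p = Fin.zero , refl , here
at⇒∈ (a Vec.∷ S)    (suc i) p = let x , e , q = at⇒∈ S i p in Fin.suc x , cong suc e , there q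

difference⇒sum : ∀ x y i k → pos x ℤ.- pos y ≡ pos i ℤ.- pos k → x + k ≡ i + y
difference⇒sum x y i k eq = ℤₚ.+-injective (begin
  pos (x + k)                          ≡⟨ ℤₚ.pos-+ x k ⟩
  pos x ℤ.+ pos k                        ≡⟨ lemma (pos x) (pos y) (pos k) ⟩
  pos x ℤ.- pos y ℤ.+ (pos y ℤ.+ pos k)      ≡⟨ cong (ℤ._+ (pos y ℤ.+ pos k)) eq ⟩
  pos i ℤ.- pos k ℤ.+ (pos y ℤ.+ pos k)      ≡⟨ lemma′ (pos i) (pos y) (pos k) ⟩
  pos i ℤ.+ pos y                        ≡⟨ ℤₚ.pos-+ i y ⟨
  pos (i + y)                          ∎)
  where
  open ≡-Reasoning
  lemma : ∀ x y k → x ℤ.+ k ≡ x ℤ.- y ℤ.+ (y ℤ.+ k)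
  lemma = ℤ-Solver.solve-∀
  lemma′ : ∀ i y k → i ℤ.- k ℤ.+ (y ℤ.+ k) ≡ i ℤ.+ y
  lemma′ = ℤ-Solver.solve-∀

sum⇒difference : ∀ x y i k → x + k ≡ i + y → pos x ℤ.- pos y ≡ pos i ℤ.- pos k
sum⇒difference x y i k eq = begin
  pos x ℤ.- pos y                        ≡⟨ lemma (pos x) (pos y) (pos k) ⟩
  pos x ℤ.+ pos k ℤ.- (pos y ℤ.+ pos k)      ≡⟨ cong (ℤ._- (pos y ℤ.+ pos k)) (ℤₚ.pos-+ x k) ⟨
  pos (x + k) ℤ.- (pos y ℤ.+ pos k)        ≡⟨ cong (λ s → pos s ℤ.- (pos y ℤ.+ pos k)) eq ⟩
  pos (i + y) ℤ.- (pos y ℤ.+ pos k)        ≡⟨ cong (ℤ._- (pos y ℤ.+ pos k)) (ℤₚ.pos-+ i y) ⟩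
  pos i ℤ.+ pos y ℤ.- (pos y ℤ.+ pos k)      ≡⟨ lemma′ (pos i) (pos y) (pos k) ⟩
  pos i ℤ.- pos k                        ∎
  where
  open ≡-Reasoning
  lemma : ∀ x y k → x ℤ.- y ≡ x ℤ.+ k ℤ.- (y ℤ.+ k)
  lemma = ℤ-Solver.solve-∀
  lemma′ : ∀ i y k → i ℤ.+ y ℤ.- (y ℤ.+ k) ≡ i ℤ.- k
  lemma′ = ℤ-Solver.solve-∀

InDiff⇒at : ∀ {n} (S : Subset n) i k → InDiff S (pos i ℤ.- pos k) →
  ∃ λ x → ∃ λ y → at (toList S) x ≡ true × at (toList S) y ≡ true × x + k ≡ i + y
InDiff⇒at S i k p =
  let x , q = satisfied p
      y , x∈S , y∈S , eq = satisfied q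
  in toℕ x , toℕ y , ∈⇒at x∈S , ∈⇒at y∈S , difference⇒sum (toℕ x) (toℕ y) i k eq

at⇒InDiff : ∀ {n} (S : Subset n) i k x y → at (toList S) x ≡ true → at (toList S) y ≡ true →
  x + k ≡ i + y → InDiff S (pos i ℤ.- pos k)
at⇒InDiff S i k x y p q eq with at⇒∈ S x p | at⇒∈ S y q
... | x′ , refl , x∈S | y′ , refl , y∈S =
  lose (∈-allFin x′) (lose (∈-allFin y′) (x∈S , y∈S , sum⇒difference x y i k eq))

does-≡ : ∀ {A : Set} (A? : Dec A) b → (A → b ≡ true) → (b ≡ true → A) → does A? ≡ b
does-≡ (yes a) b     f g = sym (f a)
does-≡ (no ¬a) true  f g = contradiction (g refl) ¬a
does-≡ (no ¬a) false f g = refl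

inDiff-nonneg : ∀ {n} (S : Subset n) k d →
  does (inDiff? S (pos (k + d) ℤ.- pos k)) ≡ hit (toList S) (drop d (toList S))
inDiff-nonneg S k d = does-≡ (inDiff? S _) _ to from
  where
  l = toList S
  to : InDiff S (pos (k + d) ℤ.- pos k) → hit l (drop d l) ≡ true
  to p = let x , y , p , q , eq = InDiff⇒at S (k + d) k p in
    at⇒hit l (drop d l) y q (trans (at-drop d l y) (trans (cong (at l) (sym (+-cancelʳ-≡ k x (d + y) (trans eq (lemma k d y))))) p))
    where
    lemma : ∀ k d y → k + d + y ≡ d + y + k
    lemma = solve-∀
  from : hit l (drop d l) ≡ true → InDiff S (pos (k + d) ℤ.- pos k)
  from h = let j , p , q = hit⇒at l (drop d l) h in
    at⇒InDiff S (k + d) k (d + j) j (trans (sym (at-drop d l j)) q) p (lemma d j k)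
    where
    lemma : ∀ d j k → d + j + k ≡ k + d + j
    lemma = solve-∀

inDiff-neg : ∀ {n} (S : Subset n) i e →
  does (inDiff? S (pos i ℤ.- pos (i + e))) ≡ hit (toList S) (drop e (toList S))
inDiff-neg S i e = does-≡ (inDiff? S _) _ to from
  where
  l = toList S
  to : InDiff S (pos i ℤ.- pos (i + e)) → hit l (drop e l) ≡ true
  to p = let x , y , p , q , eq = InDiff⇒at S i (i + e) p in
    at⇒hit l (drop e l) x p (trans (at-drop e l x) (trans (cong (at l) (+-cancelˡ-≡ i (e + x) y (trans (lemma i e x) eq))) q))
    where
    lemma : ∀ i e x → i + (e + x) ≡ x + (i + e)
    lemma = solve-∀
  from : hit l (drop e l) ≡ true → InDiff S (pos i ℤ.- pos (i + e))
  from h = let j , p , q = hit⇒at l (drop e l) h in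
    at⇒InDiff S i (i + e) j (e + j) p (trans (sym (at-drop e l j)) q) (lemma i e j)
    where
    lemma : ∀ i e j → j + (i + e) ≡ i + (e + j)
    lemma = solve-∀

length-filter-map : ∀ {A B : Set} {Q : Pred B 0ℓ} (Q? : Decidable Q) (g : A → B) xs →
  length (filter Q? (map g xs)) ≡ length (filter (Q? ∘ g) xs)
length-filter-map Q? g []       = refl
length-filter-map Q? g (x ∷ xs) with does (Q? (g x))
... | true  = cong suc (length-filter-map Q? g xs)
... | false = length-filter-map Q? g xs

length-filter-upTo : ∀ {A : Set} {Q : Pred A 0ℓ} (Q? : Decidable Q) (g : ℕ → A) (f : ℕ → ℕ) N →
  length (filter Q? (map g (applyUpTo f N))) + Σr N (λ i → gap (does (Q? (g (f i))))) ≡ N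
length-filter-upTo Q? g f zero    = refl
length-filter-upTo Q? g f (suc N) with does (Q? (g (f 0)))
... | true  = cong suc (length-filter-upTo Q? g (f ∘ suc) N)
... | false = trans (+-suc _ _) (cong suc (length-filter-upTo Q? g (f ∘ suc) N))

-- With one word in both places, `hit l (drop d l)` says that d is a difference, so `miss l l`
-- counts the missing d ≥ 0. Doubling accounts for the negatives, and the subtraction undoes it for
-- d = 0.
missingW : Word → ℕ
missingW l = 2 * miss l l ∸ gap (hit l l)

toList-length : ∀ {n} (S : Subset n) → length (toList S) ≡ n
toList-length Vec.[]      = refl
toList-length (a Vec.∷ S) = cong suc (toList-length S)

missing-toList : ∀ {k} (S : Subset (suc k)) → missing S ≡ missingW (toList S)
missing-toList {k} S = begin
  N ∸ diffCard S
    ≡⟨ cong (_∸ diffCard S) (length-filter-upTo (inDiff? S) (λ i → pos i ℤ.- pos k) id N) ⟨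
  diffCard S + Σr N G ∸ diffCard S
    ≡⟨ m+n∸m≡n (diffCard S) _ ⟩
  Σr N G
    ≡⟨ Σr-++ k (suc (k + 0)) G ⟩
  Σr k G + Σr (suc (k + 0)) (λ d → G (k + d))
    ≡⟨ cong₂ _+_ (Σr-cong k negative) (trans (cong (λ j → Σr (suc j) (λ d → G (k + d))) (+-identityʳ k)) (Σr-cong (suc k) λ d _ → cong gap (inDiff-nonneg S k d))) ⟩
  Σr k (λ i → D (k ∸ i)) + Σr (suc k) D
    ≡⟨ cong (_+ Σr (suc k) D) (Σr-reverse k D) ⟩
  R + (D 0 + R)
    ≡⟨ m+n∸m≡n (D 0) (R + (D 0 + R)) ⟨
  D 0 + (R + (D 0 + R)) ∸ D 0
    ≡⟨ cong (_∸ D 0) (lemma (D 0) R) ⟩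
  2 * (D 0 + R) ∸ D 0
    ≡⟨ cong (λ m → 2 * m ∸ D 0) (trans (miss-Σr l l) (cong (λ j → Σr j D) (toList-length S))) ⟨
  missingW l ∎
  where
  open ≡-Reasoning
  l = toList S
  N = k + suc (k + 0)
  G : ℕ → ℕ
  G i = gap (does (inDiff? S (pos i ℤ.- pos k)))
  D : ℕ → ℕ
  D d = gap (hit l (drop d l))
  R = Σr k (D ∘ suc)
  negative : ∀ i → i < k → G i ≡ D (k ∸ i)
  negative i i<k = cong gap (trans
    (cong (λ j → does (inDiff? S (pos i ℤ.- pos j))) (sym (m+[n∸m]≡n (<⇒≤ i<k))))
    (inDiff-neg S i (k ∸ i)))
  lemma : ∀ d r → d + (r + (d + r)) ≡ 2 * (d + r)
  lemma = solve-∀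

length-filter-singleton : ∀ {A : Set} {Q : Pred A 0ℓ} (Q? : Decidable Q) x →
  length (filter Q? (x ∷ [])) ≡ (if does (Q? x) then 1 else 0)
length-filter-singleton Q? x with does (Q? x)
... | true  = refl
... | false = refl

δ-≟ : ∀ m k → (if does (m ≟ k) then 1 else 0) ≡ δ k m
δ-≟ zero    zero    = refl
δ-≟ zero    (suc k) = refl
δ-≟ (suc m) zero    = refl
δ-≟ (suc m) (suc k) = δ-≟ m k

length-filter-subsets : ∀ n (f : Subset n → ℕ) (F : Word → ℕ) k → (∀ S → f S ≡ F (toList S)) →
  length (filter (λ S → f S ≟ k) (allSubsets n)) ≡ sumW n (λ l → δ k (F l))
length-filter-subsets zero    f F k h =
  trans (length-filter-singleton (λ S → f S ≟ k) Vec.[]) (trans (δ-≟ (f Vec.[]) k) (cong (δ k) (h Vec.[])))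
length-filter-subsets (suc n) f F k h = begin
  length (filter f? (map (false Vec.∷_) (allSubsets n) ++ map (true Vec.∷_) (allSubsets n)))
    ≡⟨ cong length (filter-++ f? (map (false Vec.∷_) (allSubsets n)) _) ⟩
  length (filter f? (map (false Vec.∷_) (allSubsets n)) ++ filter f? (map (true Vec.∷_) (allSubsets n)))
    ≡⟨ length-++ (filter f? (map (false Vec.∷_) (allSubsets n))) ⟩
  length (filter f? (map (false Vec.∷_) (allSubsets n))) + length (filter f? (map (true Vec.∷_) (allSubsets n)))
    ≡⟨ cong₂ _+_ (half false) (half true) ⟩
  sumW (suc n) (λ l → δ k (F l)) ∎
  where
  open ≡-Reasoning
  f? : ∀ S → Dec (f S ≡ k)
  f? S = f S ≟ k
  half : ∀ a → length (filter f? (map (a Vec.∷_) (allSubsets n))) ≡ sumW n (λ l → δ k (F (a ∷ l)))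
  half a = trans (length-filter-map f? (a Vec.∷_) (allSubsets n))
    (length-filter-subsets n (f ∘ (a Vec.∷_)) (F ∘ (a ∷_)) k (h ∘ (a Vec.∷_)))

countMissing-sumW : ∀ n k → countMissing (suc n) k ≡ sumW (suc n) (λ l → δ k (missingW l))
countMissing-sumW n k = length-filter-subsets (suc n) missing missingW k missing-toList

-- The two ends of a random set

sumW-Σr : ∀ n N (f : ℕ → Word → ℕ) → sumW n (λ l → Σr N (λ k → f k l)) ≡ Σr N (λ k → sumW n (f k))
sumW-Σr n zero    f = trans (sumW-const n 0) (*-zeroʳ (2 ^ n))
sumW-Σr n (suc N) f = trans (sumW-+ n (f 0) _) (cong (sumW n (f 0) +_) (sumW-Σr n N (f ∘ suc)))

Σr-mono : ∀ n {f g : ℕ → ℕ} → (∀ i → i < n → f i ≤ g i) → Σr n f ≤ Σr n g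
Σr-mono zero    h = z≤n
Σr-mono (suc n) h = +-mono-≤ (h 0 z<s) (Σr-mono n λ i i<n → h (suc i) (s<s i<n))

Σr-const : ∀ n c → Σr n (λ _ → c) ≡ n * c
Σr-const zero    c = refl
Σr-const (suc n) c = cong (c +_) (Σr-const n c)

Σr-* : ∀ n c f → Σr n (λ i → c * f i) ≡ c * Σr n f
Σr-* zero    c f = sym (*-zeroʳ c)
Σr-* (suc n) c f = trans (cong (c * f 0 +_) (Σr-* n c (f ∘ suc))) (sym (*-distribˡ-+ c (f 0) _))

δ-refl : ∀ m → δ m m ≡ 1
δ-refl zero    = refl
δ-refl (suc m) = δ-refl m

δ-≢ : ∀ m n → m ≢ n → δ m n ≡ 0
δ-≢ zero    zero    m≢n = contradiction refl m≢n
δ-≢ zero    (suc n) m≢n = refl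
δ-≢ (suc m) zero    m≢n = refl
δ-≢ (suc m) (suc n) m≢n = δ-≢ m n (m≢n ∘ cong suc)

Σr-δ : ∀ N n → n < N → 1 ≤ Σr N (λ k → δ k n)
Σr-δ (suc N) zero    n<N       = s≤s z≤n
Σr-δ (suc N) (suc n) (s≤s n<N) = Σr-δ N n n<N

δ-* : ∀ c .{{_ : NonZero c}} m n → δ (c * m) (c * n) ≡ δ m n
δ-* c m n with m ≟ n
... | yes refl = trans (δ-refl (c * m)) (sym (δ-refl m))
... | no m≢n   = trans (δ-≢ (c * m) (c * n) (m≢n ∘ *-cancelˡ-≡ m n c)) (sym (δ-≢ m n m≢n))

hit-take : ∀ h l w → length w ≤ h → hit l w ≡ hit (take h l) w
hit-take h       l           []          w≤h       = trans (hit-[] l) (sym (hit-[] (take h l)))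
hit-take (suc h) []          (b ∷ w)     w≤h       = refl
hit-take (suc h) (true  ∷ l) (true  ∷ w) w≤h       = refl
hit-take (suc h) (true  ∷ l) (false ∷ w) (s≤s w≤h) = hit-take h l w w≤h
hit-take (suc h) (false ∷ l) (b ∷ w)     (s≤s w≤h) = hit-take h l w w≤h

take-length-++ : ∀ (u x : Word) → take (length u) (u ++ x) ≡ u
take-length-++ []      x = refl
take-length-++ (a ∷ u) x = cong (a ∷_) (take-length-++ u x)

drop-length-++ : ∀ (u x : Word) → drop (length u) (u ++ x) ≡ x
drop-length-++ []      x = refl
drop-length-++ (a ∷ u) x = drop-length-++ u x

small : ℕ → Word → ℕ
small c l = Σr c (λ d → gap (hit l (drop d l)))

module Ends (h e : ℕ) where

  c : ℕ
  c = h + e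

  -- Here A and n - 1 - B are the two ends of the word.
  ends : Word → ℕ
  ends l = miss (take h l) (drop c l)

  -- A difference of at least `c` can only join one of the first `h` positions to one of the last
  -- `h`.
  miss-split : ∀ l → length l ≡ c + h → miss l l ≡ small c l + ends l
  miss-split l len = begin
    miss l l
      ≡⟨ miss-Σr l l ⟩
    Σr (length l) D
      ≡⟨ cong (λ n → Σr n D) len ⟩
    Σr (c + h) D
      ≡⟨ Σr-++ c h D ⟩
    small c l + Σr h (λ d → D (c + d))
      ≡⟨ cong (small c l +_) (Σr-cong h λ d _ → cong gap (trans
           (cong (hit l) (sym (drop-drop c d l))) (hit-take h l _ (short d)))) ⟩
    small c l + Σr h (λ d → gap (hit (take h l) (drop d (drop c l))))
      ≡⟨ cong (λ n → small c l + Σr n (λ d → gap (hit (take h l) (drop d (drop c l))))) length-end ⟨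
    small c l + Σr (length (drop c l)) (λ d → gap (hit (take h l) (drop d (drop c l))))
      ≡⟨ cong (small c l +_) (miss-Σr (take h l) (drop c l)) ⟨
    small c l + ends l ∎
    where
    open ≡-Reasoning
    D : ℕ → ℕ
    D d = gap (hit l (drop d l))
    length-end : length (drop c l) ≡ h
    length-end = trans (length-drop c l) (trans (cong (_∸ c) len) (m+n∸m≡n c h))
    short : ∀ d → length (drop d (drop c l)) ≤ h
    short d = ≤-trans (≤-reflexive (length-drop d (drop c l)))
      (≤-trans (m∸n≤m _ d) (≤-reflexive length-end))

  sumW-ends : ∀ f → sumW (c + h) (f ∘ ends) ≡ 2 ^ e * X h f
  sumW-ends f = begin
    sumW (c + h) (f ∘ ends)
      ≡⟨ trans (sumW-++ c h _) (sumW-++ h e _) ⟩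
    sumW h (λ u → sumW e (λ x → sumW h (λ v → f (ends ((u ++ x) ++ v)))))
      ≡⟨ sumW-cong h (λ u lu → sumW-cong e λ x lx → sumW-cong h λ v _ → cong f (ends-++ u x v lu lx)) ⟩
    sumW h (λ u → sumW e (λ x → sumW h (λ v → f (miss u v))))
      ≡⟨ sumW-cong h (λ u _ → sumW-const e _) ⟩
    sumW h (λ u → 2 ^ e * sumW h (λ v → f (miss u v)))
      ≡⟨ sumW-* h (2 ^ e) _ ⟩
    2 ^ e * X h f ∎
    where
    open ≡-Reasoning
    ends-++ : ∀ u x v → length u ≡ h → length x ≡ e → ends ((u ++ x) ++ v) ≡ miss u v
    ends-++ u x v refl refl = cong₂ miss
      (trans (cong (take (length u)) (++-assoc u x v)) (take-length-++ u (x ++ v)))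
      (trans (cong (λ n → drop n ((u ++ x) ++ v)) (sym (length-++ u))) (drop-length-++ (u ++ x) v))

  module _ (c>0 : 0 < c) where

    missing-even : ∀ l → length l ≡ c + h → small c l ≡ 0 → missingW l ≡ 2 * ends l
    missing-even l len none = begin
      2 * miss l l ∸ gap (hit l l)
        ≡⟨ cong₂ (λ x y → 2 * x ∸ y) (trans (miss-split l len) (cong (_+ ends l) none)) (n≤0⇒n≡0 (≤-trans zeroth (≤-reflexive none))) ⟩
      2 * ends l ∎
      where
      open ≡-Reasoning
      first : ∀ c → 0 < c → (D : ℕ → ℕ) → D 0 ≤ Σr c D
      first (suc c) _ D = m≤m+n (D 0) _
      zeroth : gap (hit l l) ≤ small c l
      zeroth = first c c>0 (λ d → gap (hit l (drop d l)))

    -- A union bound for the words lacking some difference below `c`, each counted with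
    -- multiplicity.
    E : ℕ
    E = sumW (c + h) (small c)

    cnt : ℕ → ℕ
    cnt k = sumW (c + h) (λ l → δ k (missingW l))

    cnt-≤ : ∀ m → cnt (2 * m) ≤ 2 ^ e * X h (δ m) + E
    cnt-≤ m = ≤-trans (sumW-mono (c + h) pointwise)
      (≤-reflexive (trans (sumW-+ (c + h) (δ m ∘ ends) (small c)) (cong (_+ E) (sumW-ends (δ m)))))
      where
      pointwise : ∀ l → length l ≡ c + h → δ (2 * m) (missingW l) ≤ δ m (ends l) + small c l
      pointwise l len with small c l in eq
      ... | zero  = ≤-trans (≤-reflexive (trans (cong (δ (2 * m)) (missing-even l len eq)) (δ-* 2 m (ends l)))) (m≤m+n _ 0)
      ... | suc s = ≤-trans (δ≤1 (2 * m) (missingW l)) (≤-trans (s≤s z≤n) (m≤n+m (suc s) _))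

    cnt-≥ : ∀ m → 2 ^ e * X h (δ m) ≤ cnt (2 * m) + E
    cnt-≥ m = ≤-trans (≤-reflexive (sym (sumW-ends (δ m)))) (≤-trans (sumW-mono (c + h) pointwise)
      (≤-reflexive (sumW-+ (c + h) (λ l → δ (2 * m) (missingW l)) (small c))))
      where
      pointwise : ∀ l → length l ≡ c + h → δ m (ends l) ≤ δ (2 * m) (missingW l) + small c l
      pointwise l len with small c l in eq
      ... | zero  = ≤-trans (≤-reflexive (sym (trans (cong (δ (2 * m)) (missing-even l len eq)) (δ-* 2 m (ends l))))) (m≤m+n _ 0)
      ... | suc s = ≤-trans (δ≤1 m _) (≤-trans (s≤s z≤n) (m≤n+m (suc s) _))

    cnt-odd : ∀ m → cnt (suc (2 * m)) ≤ E
    cnt-odd m = sumW-mono (c + h) pointwise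
      where
      odd≢even : ∀ m n → suc (2 * m) ≢ 2 * n
      odd≢even m n eq = even≢odd n m (sym eq)
      pointwise : ∀ l → length l ≡ c + h → δ (suc (2 * m)) (missingW l) ≤ small c l
      pointwise l len with small c l in eq
      ... | zero  = ≤-reflexive (trans (cong (δ (suc (2 * m))) (missing-even l len eq)) (δ-≢ (suc (2 * m)) (2 * ends l) (odd≢even m (ends l))))
      ... | suc s = ≤-trans (δ≤1 (suc (2 * m)) (missingW l)) (s≤s z≤n)

    -- Markov's inequality word by word: a word lacks fewer than `2 * K` differences, or lacks a
    -- small one, or has `ends` at least `K`.
    cnt-markov : ∀ K → 2 ^ (c + h) * K ≤ K * Σr (2 * K) cnt + K * E + 2 ^ e * X h id
    cnt-markov K = begin
      2 ^ (c + h) * K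
        ≡⟨ sumW-const (c + h) K ⟨
      sumW (c + h) (λ _ → K)
        ≤⟨ sumW-mono (c + h) pointwise ⟩
      sumW (c + h) (λ l → K * hits l + K * small c l + ends l)
        ≡⟨ trans (sumW-+ (c + h) (λ l → K * hits l + K * small c l) ends)
             (cong (_+ sumW (c + h) ends) (sumW-+ (c + h) (λ l → K * hits l) (λ l → K * small c l))) ⟩
      sumW (c + h) (λ l → K * hits l) + sumW (c + h) (λ l → K * small c l) + sumW (c + h) ends
        ≡⟨ cong₂ _+_ (cong₂ _+_
             (trans (sumW-* (c + h) K hits) (cong (K *_) (sumW-Σr (c + h) (2 * K) (λ k l → δ k (missingW l)))))
             (sumW-* (c + h) K (small c)))
             (sumW-ends id) ⟩
      K * Σr (2 * K) cnt + K * E + 2 ^ e * X h id ∎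
      where
      open ≤-Reasoning
      hits : Word → ℕ
      hits l = Σr (2 * K) (λ k → δ k (missingW l))
      pointwise : ∀ l → length l ≡ c + h → K ≤ K * hits l + K * small c l + ends l
      pointwise l len with small c l in eq
      ... | suc s = ≤-trans (m≤m*n K (suc s)) (≤-trans (m≤n+m _ (K * hits l)) (m≤m+n _ (ends l)))
      ... | zero with ends l <? K
      ...   | no  K≰ = ≤-trans (≮⇒≥ K≰) (m≤n+m (ends l) _)
      ...   | yes l<K = ≤-trans (≤-trans (≤-trans (≤-reflexive (sym (*-identityʳ K))) (*-monoʳ-≤ K one)) (m≤m+n _ (K * 0))) (m≤m+n _ (ends l))
        where
        one : 1 ≤ hits l
        one = ≤-trans (Σr-δ (2 * K) (2 * ends l) (*-monoʳ-< 2 l<K))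
          (≤-reflexive (sym (cong (λ m → Σr (2 * K) (λ k → δ k m)) (missing-even l len eq))))

-- From empty words the expected number of gaps is at most `tailBound [] [] [] = 3`.
X-id-≤ : ∀ h → X h id ≤ 4 ^ h * 3
X-id-≤ h = ≤-trans (≤-reflexive (trans (X-Ext h id) (sym (*-identityˡ _)))) (Ext-miss-≤ h [] [] refl)

-- Small differences are rarely missing

noDiff : ℕ → ℕ → ℕ
noDiff n d = sumW n (λ l → gap (hit l (drop d l)))

gap≤1 : ∀ b → gap b ≤ 1
gap≤1 true  = z≤n
gap≤1 false = ≤-refl

gap-false : ∀ h h₁ h₂ → (h₁ ≡ true → h ≡ true) → (h₂ ≡ true → h ≡ true) → gap h ≤ gap h₁ * gap h₂
gap-false true  h₁    h₂    f g = z≤n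
gap-false false true  h₂    f g with () ← f refl
gap-false false false true  f g with () ← g refl
gap-false false false false f g = ≤-refl

hit-++ : ∀ u v x y → length u ≡ length v → hit (u ++ x) (v ++ y) ≡ hit u v ∨ hit x y
hit-++ []          []          x y l = refl
hit-++ (true  ∷ u) (true  ∷ v) x y l = refl
hit-++ (true  ∷ u) (false ∷ v) x y l = hit-++ u v x y (suc-injective l)
hit-++ (false ∷ u) (b ∷ v)     x y l = hit-++ u v x y (suc-injective l)

at-++ : ∀ v R i → at (v ++ R) (length v + i) ≡ at R i
at-++ []      R i = refl
at-++ (a ∷ v) R i = at-++ v R i

-- The d pairs at distance d between the first two blocks of length d are disjoint from one another
-- and from those inside the rest. Forgetting the pairs between the second block and the rest makes
-- the count a product.
noDiff-step : ∀ d n → noDiff (d + (d + n)) d ≤ 3 ^ d * noDiff n d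
noDiff-step d n = begin
  noDiff (d + (d + n)) d
    ≡⟨ trans (sumW-++ d (d + n) _) (sumW-cong d λ u _ → sumW-++ d n _) ⟩
  sumW d (λ u → sumW d (λ v → sumW n (λ R → D (u ++ v ++ R))))
    ≤⟨ sumW-mono d (λ u lu → sumW-mono d λ v lv → sumW-mono n λ R _ → pointwise u v R lu lv) ⟩
  sumW d (λ u → sumW d (λ v → sumW n (λ R → gap (hit u v) * D R)))
    ≡⟨ sumW-cong d (λ u _ → trans
         (sumW-cong d λ v _ → trans (sumW-* n (gap (hit u v)) D) (*-comm (gap (hit u v)) _))
         (sumW-* d (noDiff n d) (gap ∘ hit u))) ⟩
  sumW d (λ u → noDiff n d * sumW d (λ v → gap (hit u v)))
    ≡⟨ sumW-* d (noDiff n d) _ ⟩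
  noDiff n d * sumW d (λ u → sumW d (λ v → gap (hit u v)))
    ≡⟨ cong (noDiff n d *_) (trans
         (sumW-cong d λ u _ → sumW-cong d λ v _ → cong (gap ∘ hit u) (sym (++-identityʳ v)))
         (trans (sym (Ext-sumW d [] [] (λ u v → gap (hit u v))))
           (trans (sym (*-identityˡ _)) (trans (Ext-gap d [] [] refl) (Φ-[] d))))) ⟩
  noDiff n d * 3 ^ d
    ≡⟨ *-comm (noDiff n d) (3 ^ d) ⟩
  3 ^ d * noDiff n d ∎
  where
  open ≤-Reasoning
  D : Word → ℕ
  D l = gap (hit l (drop d l))
  pointwise : ∀ u v R → length u ≡ d → length v ≡ d → D (u ++ v ++ R) ≤ gap (hit u v) * D R
  pointwise u v R refl lv = gap-false _ (hit u v) (hit R (drop d R))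
    (λ p → trans whole (cong (_∨ hit (v ++ R) R) p))
    (λ p → trans whole (trans (cong (hit u v ∨_) (shifted p)) (∨-zeroʳ (hit u v))))
    where
    whole : hit (u ++ v ++ R) (drop (length u) (u ++ v ++ R)) ≡ hit u v ∨ hit (v ++ R) R
    whole = trans (cong (hit (u ++ v ++ R)) (drop-length-++ u (v ++ R))) (hit-++ u v (v ++ R) R (sym lv))
    shifted : hit R (drop d R) ≡ true → hit (v ++ R) R ≡ true
    shifted p = let i , a , b = hit⇒at R (drop d R) p in
      at⇒hit (v ++ R) R (length v + i) (trans (at-++ v R i) a)
        (trans (cong (λ j → at R (j + i)) lv) (trans (sym (at-drop d R i)) b))

noDiff-≤ : ∀ q r d → noDiff (q * (d + d) + r) d ≤ 3 ^ (q * d) * 2 ^ r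
noDiff-≤ zero r d = begin
  noDiff r d        ≤⟨ sumW-mono r (λ l _ → gap≤1 (hit l (drop d l))) ⟩
  sumW r (λ _ → 1)  ≡⟨ trans (sumW-const r 1) (*-comm (2 ^ r) 1) ⟩
  1 * 2 ^ r         ∎
  where open ≤-Reasoning
noDiff-≤ (suc q) r d = begin
  noDiff (d + d + q * (d + d) + r) d
    ≡⟨ cong (λ n → noDiff n d) (lemma d (q * (d + d)) r) ⟩
  noDiff (d + (d + (q * (d + d) + r))) d
    ≤⟨ noDiff-step d _ ⟩
  3 ^ d * noDiff (q * (d + d) + r) d
    ≤⟨ *-monoʳ-≤ (3 ^ d) (noDiff-≤ q r d) ⟩
  3 ^ d * (3 ^ (q * d) * 2 ^ r)
    ≡⟨ trans (sym (*-assoc (3 ^ d) _ _)) (cong (_* 2 ^ r) (sym (^-distribˡ-+-* 3 d (q * d)))) ⟩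
  3 ^ (suc q * d) * 2 ^ r ∎
  where
  open ≤-Reasoning
  lemma : ∀ d x r → d + d + x + r ≡ d + (d + (x + r))
  lemma = solve-∀

noDiff-0 : ∀ n → noDiff n 0 ≤ 1
noDiff-0 zero    = ≤-refl
noDiff-0 (suc n) = +-mono-≤ (noDiff-0 n) (≤-reflexive (trans (sumW-const n 0) (*-zeroʳ (2 ^ n))))

4^≡2^ : ∀ k → 4 ^ k ≡ 2 ^ (2 * k)
4^≡2^ k = ^-*-assoc 2 2 k

-- For d > 0 there are q d disjoint pairs with q = n / 2d ≥ 1. The remainder is at most 2d ≤ 2 q d,
-- so n ≤ 4 q d and q d ≥ κ. For d = 0 only the empty set lacks the difference.
noDiff-decay : ∀ n d κ → 4 * κ ≤ n → d + d ≤ n → 4 ^ κ * noDiff n d ≤ 3 ^ κ * 2 ^ n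
noDiff-decay n zero κ 4κ≤n _ = begin
  4 ^ κ * noDiff n 0   ≤⟨ *-monoʳ-≤ (4 ^ κ) (noDiff-0 n) ⟩
  4 ^ κ * 1            ≡⟨ trans (*-identityʳ _) (4^≡2^ κ) ⟩
  2 ^ (2 * κ)          ≤⟨ ^-monoʳ-≤ 2 (≤-trans (*-monoˡ-≤ κ {2} {4} (s≤s (s≤s z≤n))) 4κ≤n) ⟩
  2 ^ n                ≤⟨ m≤n*m (2 ^ n) (3 ^ κ) {{m^n≢0 3 κ}} ⟩
  3 ^ κ * 2 ^ n        ∎
  where open ≤-Reasoning
noDiff-decay n d@(suc d-1) κ 4κ≤n 2d≤n = begin
  4 ^ κ * noDiff n d
    ≡⟨ cong (λ n → 4 ^ κ * noDiff n d) n≡ ⟩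
  4 ^ κ * noDiff (q * (d + d) + r) d
    ≤⟨ *-monoʳ-≤ (4 ^ κ) (noDiff-≤ q r d) ⟩
  4 ^ κ * (3 ^ k * 2 ^ r)
    ≡⟨ cong (λ x → 4 ^ κ * (x * 2 ^ r)) (trans (cong (3 ^_) (sym κ+j)) (^-distribˡ-+-* 3 κ j)) ⟩
  4 ^ κ * (3 ^ κ * 3 ^ j * 2 ^ r)
    ≤⟨ *-monoʳ-≤ (4 ^ κ) (*-monoˡ-≤ (2 ^ r) (*-monoʳ-≤ (3 ^ κ) (^-monoˡ-≤ j {3} {4} (s≤s (s≤s (s≤s z≤n)))))) ⟩
  4 ^ κ * (3 ^ κ * 4 ^ j * 2 ^ r)
    ≡⟨ lemma (4 ^ κ) (3 ^ κ) (4 ^ j) (2 ^ r) ⟩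
  3 ^ κ * (4 ^ κ * 4 ^ j * 2 ^ r)
    ≡⟨ cong (λ x → 3 ^ κ * (x * 2 ^ r)) (trans (sym (^-distribˡ-+-* 4 κ j)) (trans (cong (4 ^_) κ+j) (4^≡2^ k))) ⟩
  3 ^ κ * (2 ^ (2 * k) * 2 ^ r)
    ≡⟨ cong (3 ^ κ *_) (trans (sym (^-distribˡ-+-* 2 (2 * k) r)) (cong (2 ^_) (sym n≡2k+r))) ⟩
  3 ^ κ * 2 ^ n ∎
  where
  open ≤-Reasoning
  q = n / (d + d)
  r = n % (d + d)
  k = q * d
  n≡ : n ≡ q * (d + d) + r
  n≡ = trans (m≡m%n+[m/n]*n n (d + d)) (+-comm r _)
  n≡2k+r : n ≡ 2 * k + r
  n≡2k+r = trans n≡ (cong (_+ r) (double-* q d))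
    where
    double-* : ∀ q d → q * (d + d) ≡ 2 * (q * d)
    double-* = solve-∀
  1≤q : 1 ≤ q
  1≤q = m≥n⇒m/n>0 2d≤n
  r≤2k : r ≤ 2 * k
  r≤2k = begin
    r                ≤⟨ <⇒≤ (m%n<n n (d + d)) ⟩
    d + d            ≡⟨ *-identityˡ (d + d) ⟨
    1 * (d + d)      ≤⟨ *-monoˡ-≤ (d + d) 1≤q ⟩
    q * (d + d)      ≡⟨ double-* q d ⟩
    2 * (q * d)      ∎
    where
    double-* : ∀ q d → q * (d + d) ≡ 2 * (q * d)
    double-* = solve-∀
  κ≤k : κ ≤ k
  κ≤k = *-cancelˡ-≤ 4 (begin
    4 * κ           ≤⟨ 4κ≤n ⟩
    n               ≡⟨ n≡2k+r ⟩
    2 * k + r       ≤⟨ +-monoʳ-≤ (2 * k) r≤2k ⟩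
    2 * k + 2 * k   ≡⟨ *-distribʳ-+ k 2 2 ⟨
    4 * k           ∎)
  j = k ∸ κ
  κ+j : κ + j ≡ k
  κ+j = m+[n∸m]≡n κ≤k
  lemma : ∀ a b c d → a * (b * c * d) ≡ b * (a * c * d)
  lemma = solve-∀

small-decay : ∀ n c κ → 4 * κ ≤ n → (∀ d → d < c → d + d ≤ n) →
  4 ^ κ * sumW n (small c) ≤ c * (3 ^ κ * 2 ^ n)
small-decay n c κ 4κ≤n c≤ = begin
  4 ^ κ * sumW n (small c)                 ≡⟨ cong (4 ^ κ *_) (sumW-Σr n c (λ d l → gap (hit l (drop d l)))) ⟩
  4 ^ κ * Σr c (noDiff n)                  ≡⟨ Σr-* c (4 ^ κ) (noDiff n) ⟨
  Σr c (λ d → 4 ^ κ * noDiff n d)          ≤⟨ Σr-mono c (λ d d<c → noDiff-decay n d κ 4κ≤n (c≤ d d<c)) ⟩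
  Σr c (λ _ → 3 ^ κ * 2 ^ n)               ≡⟨ Σr-const c (3 ^ κ * 2 ^ n) ⟩
  c * (3 ^ κ * 2 ^ n)                      ∎
  where open ≤-Reasoning

-- Rational limits

frac-sum-numerator : ∀ b y c q →
  pos b ℤ.* pos q ℤ.+ pos c ℤ.* pos y ≡ pos (b * q + c * y)
frac-sum-numerator b y c q = trans (cong₂ ℤ._+_ (sym (ℤₚ.pos-* b q)) (sym (ℤₚ.pos-* c y))) (sym (ℤₚ.pos-+ (b * q) (c * y)))

toℚᵘ-frac-+ : ∀ b y c q →
  toℚᵘ (pos b ℚ./ suc y ℚ.+ pos c ℚ./ suc q) ℚᵘ.≃ mkℚᵘ (pos b) y ℚᵘ.+ mkℚᵘ (pos c) q
toℚᵘ-frac-+ b y c q = ℚᵘₚ.≃-trans (ℚₚ.toℚᵘ-homo-+ (pos b ℚ./ suc y) (pos c ℚ./ suc q))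
  (ℚᵘₚ.+-cong (ℚₚ.toℚᵘ-fromℚᵘ (mkℚᵘ (pos b) y)) (ℚₚ.toℚᵘ-fromℚᵘ (mkℚᵘ (pos c) q)))

frac-≤-+ : ∀ a x b y c q .{{_ : NonZero x}} .{{_ : NonZero y}} .{{_ : NonZero q}} →
  a * (y * q) ≤ (b * q + c * y) * x → pos a ℚ./ x ℚ.≤ pos b ℚ./ y ℚ.+ pos c ℚ./ q
frac-≤-+ a (suc x) b (suc y) c (suc q) le = ℚₚ.toℚᵘ-cancel-≤
  (ℚᵘₚ.≤-respˡ-≃ (ℚᵘₚ.≃-sym (ℚₚ.toℚᵘ-fromℚᵘ (mkℚᵘ (pos a) x)))
    (ℚᵘₚ.≤-respʳ-≃ (ℚᵘₚ.≃-sym (toℚᵘ-frac-+ b y c q))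
      (ℚᵘ.*≤* (subst₂ ℤ._≤_ (ℤₚ.pos-* a (suc y * suc q))
        (trans (ℤₚ.pos-* (b * suc q + c * suc y) (suc x))
          (cong (ℤ._* pos (suc x)) (sym (frac-sum-numerator b (suc y) c (suc q)))))
        (ℤ.+≤+ le)))))

frac-+-≤ : ∀ a x b y c q .{{_ : NonZero x}} .{{_ : NonZero y}} .{{_ : NonZero q}} →
  (b * q + c * y) * x ≤ a * (y * q) → pos b ℚ./ y ℚ.+ pos c ℚ./ q ℚ.≤ pos a ℚ./ x
frac-+-≤ a (suc x) b (suc y) c (suc q) le = ℚₚ.toℚᵘ-cancel-≤
  (ℚᵘₚ.≤-respʳ-≃ (ℚᵘₚ.≃-sym (ℚₚ.toℚᵘ-fromℚᵘ (mkℚᵘ (pos a) x)))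
    (ℚᵘₚ.≤-respˡ-≃ (ℚᵘₚ.≃-sym (toℚᵘ-frac-+ b y c q))
      (ℚᵘ.*≤* (subst₂ ℤ._≤_
        (trans (ℤₚ.pos-* (b * suc q + c * suc y) (suc x))
          (cong (ℤ._* pos (suc x)) (sym (frac-sum-numerator b (suc y) c (suc q)))))
        (ℤₚ.pos-* a (suc y * suc q))
        (ℤ.+≤+ le)))))

frac-≤ : ∀ a x b y .{{_ : NonZero x}} .{{_ : NonZero y}} → a * y ≤ b * x → pos a ℚ./ x ℚ.≤ pos b ℚ./ y
frac-≤ a (suc x) b (suc y) le = ℚₚ.toℚᵘ-cancel-≤
  (ℚᵘₚ.≤-respˡ-≃ (ℚᵘₚ.≃-sym (ℚₚ.toℚᵘ-fromℚᵘ (mkℚᵘ (pos a) x)))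
    (ℚᵘₚ.≤-respʳ-≃ (ℚᵘₚ.≃-sym (ℚₚ.toℚᵘ-fromℚᵘ (mkℚᵘ (pos b) y)))
      (ℚᵘ.*≤* (subst₂ ℤ._≤_ (ℤₚ.pos-* a (suc y)) (ℤₚ.pos-* b (suc x)) (ℤ.+≤+ le)))))

frac>0 : ∀ q → 0ℚ ℚ.< pos 1 ℚ./ suc q
frac>0 q = ℚₚ.toℚᵘ-cancel-<
  (ℚᵘₚ.<-respʳ-≃ (ℚᵘₚ.≃-sym (ℚₚ.toℚᵘ-fromℚᵘ (mkℚᵘ (pos 1) q)))
    (ℚᵘ.*<* (ℤ.+<+ (s≤s z≤n))))

archimedes : ∀ (ε : ℚ) → 0ℚ ℚ.< ε → ∃ λ q → pos 2 ℚ./ suc q ℚ.< ε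
archimedes (mkℚ (pos zero)    d c) (ℚ.*<* (ℤ.+<+ ()))
archimedes (mkℚ (ℤ.-[1+ p ])  d c) (ℚ.*<* ())
archimedes (mkℚ (pos (suc p)) d c) _ = q , ℚₚ.toℚᵘ-cancel-<
  (ℚᵘₚ.<-respˡ-≃ (ℚᵘₚ.≃-sym (ℚₚ.toℚᵘ-fromℚᵘ (mkℚᵘ (pos 2) q)))
    (ℚᵘ.*<* (subst₂ ℤ._<_ (ℤₚ.pos-* 2 (suc d)) (ℤₚ.pos-* (suc p) (suc q)) (ℤ.+<+ bound))))
  where
  -- 2 / (2 (d + 1) + 1) < 1 / (d + 1) ≤ ε.
  q = 2 * suc d
  bound : 2 * suc d < suc p * suc q
  bound = m≤n*m (suc q) (suc p)

p≤q+r⇒p-q≤r : ∀ p q r → p ℚ.≤ q ℚ.+ r → p ℚ.- q ℚ.≤ r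
p≤q+r⇒p-q≤r p q r le = ℚₚ.≤-trans (ℚₚ.+-monoˡ-≤ (ℚ.- q) le) (ℚₚ.≤-reflexive (begin
  q ℚ.+ r ℚ.+ ℚ.- q      ≡⟨ cong (ℚ._+ ℚ.- q) (ℚₚ.+-comm q r) ⟩
  r ℚ.+ q ℚ.+ ℚ.- q      ≡⟨ ℚₚ.+-assoc r q (ℚ.- q) ⟩
  r ℚ.+ (q ℚ.+ ℚ.- q)    ≡⟨ cong (r ℚ.+_) (ℚₚ.+-inverseʳ q) ⟩
  r ℚ.+ 0ℚ               ≡⟨ ℚₚ.+-identityʳ r ⟩
  r                      ∎))
  where open ≡-Reasoning

∣p-q∣≤ : ∀ p q r → p ℚ.≤ q ℚ.+ r → q ℚ.≤ p ℚ.+ r → ℚ.∣ p ℚ.- q ∣ ℚ.≤ r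
∣p-q∣≤ p q r p≤ q≤ with ℚₚ.∣p∣≡p∨∣p∣≡-p (p ℚ.- q)
... | inj₁ eq = subst (ℚ._≤ r) (sym eq) (p≤q+r⇒p-q≤r p q r p≤)
... | inj₂ eq = subst (ℚ._≤ r) (sym (trans eq negate)) (p≤q+r⇒p-q≤r q p r q≤)
  where
  negate : ℚ.- (p ℚ.- q) ≡ q ℚ.- p
  negate = trans (ℚₚ.neg-distrib-+ p (ℚ.- q)) (trans (ℚₚ.+-comm (ℚ.- p) _) (cong (ℚ._+ ℚ.- p) (⁻¹-involutive q)))

2^n≢0 : ∀ n → NonZero (2 ^ n)
2^n≢0 n = m^n≢0 2 n

-- It suffices that for each Q the sequence is eventually within 1 / Q of some rational p / r; two
-- terms then differ by at most 2 / Q. As p / r may depend on Q, no rational limit is claimed.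
limitExists : ∀ k →
  (∀ Q → ∃ λ p → ∃ λ r → 0 < r × Eventually (λ n →
    Q * r * countMissing n k ≤ Q * p * 2 ^ n + r * 2 ^ n × Q * p * 2 ^ n ≤ Q * r * countMissing n k + r * 2 ^ n)) →
  LimitExists (λ n → P n k)
limitExists k approx ε ε>0 =
  let q , 2/q<ε = archimedes ε ε>0
      p , r , r>0 , N , near = approx (suc q)
      cauchy : ∀ m n → N ≤ m → N ≤ n → P m k ℚ.≤ P n k ℚ.+ pos 2 ℚ./ suc q
      cauchy m n N≤m N≤n = frac-≤-+ (countMissing m k) (2 ^ m) (countMissing n k) (2 ^ n) 2 (suc q)
        {{2^n≢0 m}} {{2^n≢0 n}}
        (*-cancelˡ-≤ r {{>-nonZero r>0}}
          (combine (suc q) r p (countMissing m k) (countMissing n k) (2 ^ m) (2 ^ n)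
            (proj₁ (near m N≤m)) (proj₂ (near n N≤n))))
  in N , λ m n N≤m N≤n → ℚₚ.≤-<-trans
       (∣p-q∣≤ (P m k) (P n k) _ (cauchy m n N≤m N≤n) (cauchy n m N≤n N≤m)) 2/q<ε
  where
  combine : ∀ Q r p a b x y → Q * r * a ≤ Q * p * x + r * x → Q * p * y ≤ Q * r * b + r * y →
    r * (a * (y * Q)) ≤ r * ((b * Q + 2 * y) * x)
  combine Q r p a b x y h₁ h₂ = begin
    r * (a * (y * Q))                ≡⟨ l₁ Q r a y ⟩
    Q * r * a * y                    ≤⟨ *-monoˡ-≤ y h₁ ⟩
    (Q * p * x + r * x) * y          ≡⟨ l₂ Q p r x y ⟩
    Q * p * y * x + r * x * y        ≤⟨ +-monoˡ-≤ (r * x * y) (*-monoˡ-≤ x h₂) ⟩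
    (Q * r * b + r * y) * x + r * x * y ≡⟨ l₃ Q r b x y ⟩
    r * ((b * Q + 2 * y) * x)        ∎
    where
    open ≤-Reasoning
    l₁ : ∀ Q r a y → r * (a * (y * Q)) ≡ Q * r * a * y
    l₁ = solve-∀
    l₂ : ∀ Q p r x y → (Q * p * x + r * x) * y ≡ Q * p * y * x + r * x * y
    l₂ = solve-∀
    l₃ : ∀ Q r b x y → (Q * r * b + r * y) * x + r * x * y ≡ r * ((b * Q + 2 * y) * x)
    l₃ = solve-∀

limitLess : ∀ a b Q → Eventually (λ n → suc Q * countMissing n a + 2 ^ n ≤ suc Q * countMissing n b) →
  LimitLess (λ n → P n a) (λ n → P n b)
limitLess a b Q (N , bound) = pos 1 ℚ./ suc Q , frac>0 Q , N , λ n N≤n →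
  frac-+-≤ (countMissing n b) (2 ^ n) (countMissing n a) (2 ^ n) 1 (suc Q) {{2^n≢0 n}} {{2^n≢0 n}}
    (≤-trans (≤-reflexive (l₁ (countMissing n a) (suc Q) (2 ^ n)))
      (≤-trans (*-monoˡ-≤ (2 ^ n) (bound n N≤n)) (≤-reflexive (l₂ (countMissing n b) (suc Q) (2 ^ n)))))
  where
  l₁ : ∀ a Q x → (a * Q + 1 * x) * x ≡ (Q * a + x) * x
  l₁ = solve-∀
  l₂ : ∀ b Q x → Q * b * x ≡ b * (x * Q)
  l₂ = solve-∀

limitPositive : ∀ k Q → Eventually (λ n → 2 ^ n ≤ suc Q * countMissing n k) → LimitPositive (λ n → P n k)
limitPositive k Q (N , bound) = pos 1 ℚ./ suc Q , frac>0 Q , N , λ n N≤n →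
  frac-≤ 1 (suc Q) (countMissing n k) (2 ^ n) {{_}} {{2^n≢0 n}}
    (≤-trans (≤-reflexive (*-identityˡ (2 ^ n))) (≤-trans (bound n N≤n) (≤-reflexive (*-comm (suc Q) _))))

limitNotPositive : ∀ k → (∀ Q → Eventually (λ n → Q * countMissing n k ≤ 2 ^ n)) →
  ¬ LimitPositive (λ n → P n k)
limitNotPositive k negligible (q , q>0 , N , q≤) =
  let Q , 2/Q<q = archimedes q q>0
      N′ , small = negligible (suc Q)
      n = N ⊔ N′
  in ℚₚ.<-irrefl refl (ℚₚ.≤-<-trans (q≤ n (m≤m⊔n N N′)) (ℚₚ.≤-<-trans
       (frac-≤ (countMissing n k) (2 ^ n) 2 (suc Q) {{2^n≢0 n}}
         (≤-trans (≤-reflexive (*-comm (countMissing n k) (suc Q)))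
           (≤-trans (small n (m≤n⊔m N N′)) (m≤n*m (2 ^ n) 2)))) 2/Q<q))

partialSum-≥ : ∀ n K (f : ℕ → ℕ) .{{_ : NonZero (2 ^ n)}} →
  pos (Σr K (countMissing n ∘ f)) ℚ./ (2 ^ n) ℚ.≤ sumℚ (map (P n) (applyUpTo f K))
partialSum-≥ n zero    f = frac-≤ 0 (2 ^ n) 0 1 z≤n
partialSum-≥ n (suc K) f = ℚₚ.≤-trans
  (frac-≤-+ (a + b) (2 ^ n) a (2 ^ n) b (2 ^ n) (≤-reflexive (l a b (2 ^ n))))
  (ℚₚ.+-monoʳ-≤ (P n (f 0)) (partialSum-≥ n K (f ∘ suc)))
  where
  a = countMissing n (f 0)
  b = Σr K (countMissing n ∘ f ∘ suc)
  l : ∀ a b x → (a + b) * (x * x) ≡ (a * x + b * x) * x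
  l = solve-∀

limitsSumToOne : (∀ Q → ∃ λ K → Eventually (λ n → Q * 2 ^ n ≤ Q * Σr K (countMissing n) + 2 * 2 ^ n)) →
  LimitsSumToOne
limitsSumToOne bound ε ε>0 =
  let q , 2/q<ε = archimedes ε ε>0
      K , N , h = bound (suc q)
  in K , N , λ n N≤n → ℚₚ.<-≤-trans (ℚₚ.+-monoʳ-< 1ℚ (ℚₚ.neg-antimono-< 2/q<ε))
       (p≤q+r⇒p-q≤r 1ℚ (pos 2 ℚ./ suc q) (partialSum n K) (ℚₚ.≤-trans
         (frac-≤-+ 1 1 2 (suc q) (Σr K (countMissing n)) (2 ^ n) {{_}} {{_}} {{2^n≢0 n}}
           (≤-trans (≤-reflexive (l₁ (suc q) (2 ^ n))) (≤-trans (h n N≤n) (≤-reflexive (l₂ (suc q) (Σr K (countMissing n)) (2 ^ n))))))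
         (ℚₚ.+-monoʳ-≤ (pos 2 ℚ./ suc q) (partialSum-≥ n K id {{2^n≢0 n}}))))
  where
  l₁ : ∀ Q x → 1 * (Q * x) ≡ Q * x
  l₁ = solve-∀
  l₂ : ∀ Q s x → Q * s + 2 * x ≡ (2 * x + s * Q) * 1
  l₂ = solve-∀

-- Asymptotics

-- The step needs 6 k + 3 ≤ k², which first holds at k = 7. There 49 (3/4)^7 is about 6.54, whence
-- the other 7.
power-growth-suc : ∀ k → 7 ≤ k → k * k * 3 ^ k ≤ 7 * 4 ^ k → suc k * suc k * 3 ^ suc k ≤ 7 * 4 ^ suc k
power-growth-suc k 7≤k ih = begin
  suc k * suc k * (3 * 3 ^ k)            ≡⟨ l k (3 ^ k) ⟩
  (3 * (k * k) + 6 * k + 3) * 3 ^ k      ≤⟨ *-monoˡ-≤ (3 ^ k) quadratic ⟩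
  4 * (k * k) * 3 ^ k                    ≡⟨ *-assoc 4 (k * k) (3 ^ k) ⟩
  4 * (k * k * 3 ^ k)                    ≤⟨ *-monoʳ-≤ 4 ih ⟩
  4 * (7 * 4 ^ k)                        ≡⟨ l′ (4 ^ k) ⟩
  7 * (4 * 4 ^ k)                        ∎
  where
  open ≤-Reasoning
  l : ∀ k t → suc k * suc k * (3 * t) ≡ (3 * (k * k) + 6 * k + 3) * t
  l = solve-∀
  l′ : ∀ q → 4 * (7 * q) ≡ 7 * (4 * q)
  l′ = solve-∀
  quadratic : 3 * (k * k) + 6 * k + 3 ≤ 4 * (k * k)
  quadratic = begin
    3 * (k * k) + 6 * k + 3    ≤⟨ +-monoʳ-≤ (3 * (k * k) + 6 * k) (≤-trans (≤ᵇ⇒≤ 3 7 _) 7≤k) ⟩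
    3 * (k * k) + 6 * k + k    ≡⟨ l″ k ⟩
    3 * (k * k) + 7 * k        ≤⟨ +-monoʳ-≤ (3 * (k * k)) (*-monoˡ-≤ k 7≤k) ⟩
    3 * (k * k) + k * k        ≡⟨ +-comm (3 * (k * k)) (k * k) ⟩
    4 * (k * k)                ∎
    where
    l″ : ∀ k → 3 * (k * k) + 6 * k + k ≡ 3 * (k * k) + 7 * k
    l″ = solve-∀

power-growth : ∀ i → (i + 7) * (i + 7) * 3 ^ (i + 7) ≤ 7 * 4 ^ (i + 7)
power-growth zero    = ≤ᵇ⇒≤ 107163 114688 _
power-growth (suc i) = power-growth-suc (i + 7) (m≤n+m 7 i) (power-growth i)

-- Abstract, lest conversion checking unfolds 4 ^ threshold Q.
abstract
  threshold : ℕ → ℕ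
  threshold Q = 7 + 49 * Q

  7≤threshold : ∀ Q → 7 ≤ threshold Q
  7≤threshold Q = m≤m+n 7 (49 * Q)

  49*≤threshold : ∀ Q → 49 * Q ≤ threshold Q
  49*≤threshold Q = m≤n+m (49 * Q) 7

-- The 49 in `threshold` is 7 · 7: one factor pays for 4 κ + 3 ≤ 7 κ, the other for the constant in
-- `power-growth`.
linear*3^≤4^ : ∀ Q κ → threshold Q ≤ κ → Q * (4 * κ + 3) * 3 ^ κ ≤ 4 ^ κ
linear*3^≤4^ Q κ big = *-cancelˡ-≤ 7 (begin
  7 * (Q * (4 * κ + 3) * 3 ^ κ)    ≤⟨ *-monoʳ-≤ 7 (*-monoˡ-≤ (3 ^ κ) (*-monoʳ-≤ Q linear)) ⟩
  7 * (Q * (7 * κ) * 3 ^ κ)        ≡⟨ l Q κ (3 ^ κ) ⟩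
  49 * Q * (κ * 3 ^ κ)             ≤⟨ *-monoˡ-≤ (κ * 3 ^ κ) (≤-trans (49*≤threshold Q) big) ⟩
  κ * (κ * 3 ^ κ)                  ≡⟨ *-assoc κ κ (3 ^ κ) ⟨
  κ * κ * 3 ^ κ                    ≤⟨ subst (λ k → k * k * 3 ^ k ≤ 7 * 4 ^ k) (m∸n+n≡m 7≤κ) (power-growth (κ ∸ 7)) ⟩
  7 * 4 ^ κ                        ∎)
  where
  open ≤-Reasoning
  7≤κ : 7 ≤ κ
  7≤κ = ≤-trans (7≤threshold Q) big
  linear : 4 * κ + 3 ≤ 7 * κ
  linear = begin
    4 * κ + 3      ≤⟨ +-monoʳ-≤ (4 * κ) (≤-trans (≤ᵇ⇒≤ 3 21 _) (*-monoʳ-≤ 3 7≤κ)) ⟩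
    4 * κ + 3 * κ  ≡⟨ *-distribʳ-+ κ 4 3 ⟨
    7 * κ          ∎
  l : ∀ Q κ t → 7 * (Q * (7 * κ) * t) ≡ 49 * Q * (κ * t)
  l = solve-∀

3^≤4^ : ∀ Q h → threshold Q ≤ h → Q * 3 ^ h ≤ 4 ^ h
3^≤4^ Q h big = ≤-trans
  (*-monoˡ-≤ (3 ^ h) (m≤m*n Q (4 * h + 3) {{>-nonZero (≤-trans (s≤s z≤n) (m≤n+m 3 (4 * h)))}}))
  (linear*3^≤4^ Q h big)

-- Transfer to subsets of [n]

half parity centre : ℕ → ℕ
half n = n / 2
parity n = n % 2
centre n = half n + parity n

centre+half : ∀ n → centre n + half n ≡ n
centre+half n = trans (l (half n) (parity n)) (sym (m≡m%n+[m/n]*n n 2))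
  where
  l : ∀ h e → h + e + h ≡ e + h * 2
  l = solve-∀

2^-split : ∀ n → 2 ^ parity n * 4 ^ half n ≡ 2 ^ n
2^-split n = begin
  2 ^ parity n * 4 ^ half n          ≡⟨ cong (2 ^ parity n *_) (4^≡2^ (half n)) ⟩
  2 ^ parity n * 2 ^ (2 * half n)    ≡⟨ ^-distribˡ-+-* 2 (parity n) _ ⟨
  2 ^ (parity n + 2 * half n)        ≡⟨ cong (2 ^_) (trans (cong (parity n +_) (*-comm 2 (half n))) (sym (m≡m%n+[m/n]*n n 2))) ⟩
  2 ^ n                              ∎
  where open ≡-Reasoning

half-≤ : ∀ H n → 2 * H ≤ n → H ≤ half n
half-≤ H n 2H≤n = ≤-trans (≤-reflexive (sym (trans (cong (_/ 2) (*-comm 2 H)) (m*n/n≡m H 2)))) (/-monoˡ-≤ 2 2H≤n)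

main : ℕ → (ℕ → ℕ) → ℕ
main n f = 2 ^ parity n * X (half n) f

error : ℕ → ℕ
error n = sumW n (small (centre n))

module Transfer (n : ℕ) (n>0 : 0 < n) where

  open Ends (half n) (parity n)

  centre>0 : 0 < centre n
  centre>0 with centre n in eq
  ... | suc _ = z<s
  ... | zero  = contradiction n>0 (subst (λ m → ¬ 0 < m) (trans (cong₂ _+_ (sym eq) (sym h≡0)) (centre+half n)) λ ())
    where
    h≡0 : half n ≡ 0
    h≡0 = m+n≡0⇒m≡0 (half n) eq

  cnt≡ : ∀ k → cnt centre>0 k ≡ countMissing n k
  cnt≡ k = trans (cong (λ m → sumW m (λ l → δ k (missingW l))) (centre+half n)) (words n n>0)
    where
    words : ∀ n → 0 < n → sumW n (λ l → δ k (missingW l)) ≡ countMissing n k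
    words (suc n) _ = sym (countMissing-sumW n k)

  E≡ : E centre>0 ≡ error n
  E≡ = cong (λ m → sumW m (small (centre n))) (centre+half n)

  even-≤ : ∀ m → countMissing n (2 * m) ≤ main n (δ m) + error n
  even-≤ m = subst₂ (λ x y → x ≤ main n (δ m) + y) (cnt≡ (2 * m)) E≡ (cnt-≤ centre>0 m)

  even-≥ : ∀ m → main n (δ m) ≤ countMissing n (2 * m) + error n
  even-≥ m = subst₂ (λ x y → main n (δ m) ≤ x + y) (cnt≡ (2 * m)) E≡ (cnt-≥ centre>0 m)

  odd-≤ : ∀ m → countMissing n (suc (2 * m)) ≤ error n
  odd-≤ m = subst₂ _≤_ (cnt≡ (suc (2 * m))) E≡ (cnt-odd centre>0 m)

  total-≥ : ∀ K → K * 2 ^ n ≤ K * Σr (2 * K) (countMissing n) + K * error n + 3 * 2 ^ n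
  total-≥ K = begin
    K * 2 ^ n
      ≡⟨ trans (*-comm K (2 ^ n)) (cong (λ m → 2 ^ m * K) (sym (centre+half n))) ⟩
    2 ^ (centre n + half n) * K
      ≤⟨ cnt-markov centre>0 K ⟩
    K * Σr (2 * K) (cnt centre>0) + K * E centre>0 + main n id
      ≤⟨ +-mono-≤ (≤-reflexive (cong₂ (λ x y → K * x + K * y) (Σr-cong (2 * K) λ k _ → cnt≡ k) E≡))
           (*-monoʳ-≤ (2 ^ parity n) (X-id-≤ (half n))) ⟩
    K * Σr (2 * K) (countMissing n) + K * error n + 2 ^ parity n * (4 ^ half n * 3)
      ≡⟨ cong (K * Σr (2 * K) (countMissing n) + K * error n +_)
           (trans (sym (*-assoc (2 ^ parity n) (4 ^ half n) 3)) (trans (cong (_* 3) (2^-split n)) (*-comm (2 ^ n) 3))) ⟩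
    K * Σr (2 * K) (countMissing n) + K * error n + 3 * 2 ^ n ∎
    where open ≤-Reasoning

open Transfer using (even-≤; even-≥; odd-≤; total-≥)

abstract
  errorBound : ℕ → ℕ
  errorBound Q = 4 * suc (threshold Q)

  errorBound>0 : ∀ Q n → errorBound Q ≤ n → 0 < n
  errorBound>0 Q n le = ≤-trans (s≤s z≤n) le

  threshold≤ : ∀ Q n → errorBound Q ≤ n → threshold Q ≤ n / 4
  threshold≤ Q n le = ≤-trans (n≤1+n _)
    (≤-trans (≤-reflexive (sym (trans (cong (_/ 4) (*-comm 4 (suc (threshold Q)))) (m*n/n≡m (suc (threshold Q)) 4))))
      (/-monoˡ-≤ 4 le))

-- With κ = n / 4 there are at most 4 κ + 3 small differences, each missing from at most a fraction
-- (3/4)^κ of the sets.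
error-negligible : ∀ Q n → errorBound Q ≤ n → Q * error n ≤ 2 ^ n
error-negligible Q n le = *-cancelˡ-≤ (4 ^ κ) {{m^n≢0 4 κ}} (begin
  4 ^ κ * (Q * error n)                     ≡⟨ l₁ (4 ^ κ) Q (error n) ⟩
  Q * (4 ^ κ * error n)                     ≤⟨ *-monoʳ-≤ Q (small-decay n (centre n) κ 4κ≤n doubled) ⟩
  Q * (centre n * (3 ^ κ * 2 ^ n))          ≤⟨ *-monoʳ-≤ Q (*-monoˡ-≤ (3 ^ κ * 2 ^ n) centre≤) ⟩
  Q * ((4 * κ + 3) * (3 ^ κ * 2 ^ n))       ≡⟨ l₂ Q (4 * κ + 3) (3 ^ κ) (2 ^ n) ⟩
  Q * (4 * κ + 3) * 3 ^ κ * 2 ^ n           ≤⟨ *-monoˡ-≤ (2 ^ n) (linear*3^≤4^ Q κ (threshold≤ Q n le)) ⟩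
  4 ^ κ * 2 ^ n                             ∎)
  where
  open ≤-Reasoning
  κ = n / 4
  4κ≤n : 4 * κ ≤ n
  4κ≤n = ≤-trans (≤-reflexive (*-comm 4 κ)) (m/n*n≤m n 4)
  doubled : ∀ d → d < centre n → d + d ≤ n
  doubled d d<c = ≤-trans (+-mono-≤ d≤h d≤h)
    (≤-trans (+-monoˡ-≤ (half n) (m≤m+n (half n) (parity n))) (≤-reflexive (centre+half n)))
    where
    d≤h : d ≤ half n
    d≤h = ≤-pred (≤-trans d<c (≤-trans (+-monoʳ-≤ (half n) (≤-pred (m%n<n n 2))) (≤-reflexive (+-comm (half n) 1))))
  centre≤ : centre n ≤ 4 * κ + 3
  centre≤ = begin
    centre n         ≤⟨ m≤m+n (centre n) (half n) ⟩
    centre n + half n ≡⟨ centre+half n ⟩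
    n                ≡⟨ m≡m%n+[m/n]*n n 4 ⟩
    n % 4 + κ * 4    ≤⟨ +-monoˡ-≤ (κ * 4) (≤-pred (m%n<n n 4)) ⟩
    3 + κ * 4        ≡⟨ trans (+-comm 3 _) (cong (_+ 3) (*-comm κ 4)) ⟩
    4 * κ + 3        ∎
  l₁ : ∀ x Q e → x * (Q * e) ≡ Q * (x * e)
  l₁ = solve-∀
  l₂ : ∀ Q c t x → Q * (c * (t * x)) ≡ Q * c * t * x
  l₂ = solve-∀

-- Existence of the limits, by parity

even-or-odd : ∀ k → ∃ λ m → k ≡ 2 * m ⊎ k ≡ suc (2 * m)
even-or-odd zero = 0 , inj₁ refl
even-or-odd (suc k) with even-or-odd k
... | m , inj₁ eq = m , inj₂ (cong suc eq)
... | m , inj₂ eq = suc m , inj₁ (trans (cong suc eq) (cong suc (sym (+-suc m (m + 0)))))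

odd-negligible : ∀ m Q → Eventually (λ n → Q * countMissing n (suc (2 * m)) ≤ 2 ^ n)
odd-negligible m Q = errorBound Q , λ n le →
  ≤-trans (*-monoʳ-≤ Q (odd-≤ n (errorBound>0 Q n le) m)) (error-negligible Q n le)

odd-approx : ∀ m Q → ∃ λ p → ∃ λ r → 0 < r × Eventually (λ n →
  Q * r * countMissing n (suc (2 * m)) ≤ Q * p * 2 ^ n + r * 2 ^ n ×
  Q * p * 2 ^ n ≤ Q * r * countMissing n (suc (2 * m)) + r * 2 ^ n)
odd-approx m Q = 0 , 1 , s≤s z≤n , errorBound Q , λ n le → upper n le , lower n
  where
  upper : ∀ n → errorBound Q ≤ n → Q * 1 * countMissing n (suc (2 * m)) ≤ Q * 0 * 2 ^ n + 1 * 2 ^ n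
  upper n le = begin
    Q * 1 * countMissing n (suc (2 * m))  ≡⟨ cong (_* countMissing n (suc (2 * m))) (*-identityʳ Q) ⟩
    Q * countMissing n (suc (2 * m))      ≤⟨ proj₂ (odd-negligible m Q) n le ⟩
    2 ^ n                                 ≡⟨ *-identityˡ (2 ^ n) ⟨
    1 * 2 ^ n                             ≤⟨ m≤n+m (1 * 2 ^ n) (Q * 0 * 2 ^ n) ⟩
    Q * 0 * 2 ^ n + 1 * 2 ^ n             ∎
    where open ≤-Reasoning
  lower : ∀ n → Q * 0 * 2 ^ n ≤ Q * 1 * countMissing n (suc (2 * m)) + 1 * 2 ^ n
  lower n = ≤-trans (≤-reflexive (cong (_* 2 ^ n) (*-zeroʳ Q))) z≤n

even-approx : ∀ m Q → ∃ λ p → ∃ λ r → 0 < r × Eventually (λ n →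
  Q * r * countMissing n (2 * m) ≤ Q * p * 2 ^ n + r * 2 ^ n ×
  Q * p * 2 ^ n ≤ Q * r * countMissing n (2 * m) + r * 2 ^ n)
even-approx m Q = X H (δ m) , 4 ^ H , m^n>0 4 H , errorBound (2 * Q) ⊔ 2 * H , λ n le →
  let le₁ = ≤-trans (m≤m⊔n (errorBound (2 * Q)) (2 * H)) le
      le₂ = half-≤ H n (≤-trans (m≤n⊔m (errorBound (2 * Q)) (2 * H)) le)
  in upper n le₁ (half n ∸ H) (m∸n+n≡m le₂) , lower n le₁ (half n ∸ H) (m∸n+n≡m le₂)
  where
  -- Half of the allowed 1 / Q goes to the tail 3 (3/4)^H, which `6 * Q` makes at most 1 / (2 Q);
  -- the other half goes to the missing small differences, whence `errorBound (2 * Q)`.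
  H = threshold (6 * Q)
  x = X H (δ m)
  small-tail : 6 * Q * 3 ^ H ≤ 4 ^ H
  small-tail = 3^≤4^ (6 * Q) H ≤-refl
  2^-split′ : ∀ n j → j + H ≡ half n → 2 ^ parity n * (4 ^ j * 4 ^ H) ≡ 2 ^ n
  2^-split′ n j eq = trans (cong (2 ^ parity n *_) (trans (sym (^-distribˡ-+-* 4 j H)) (cong (4 ^_) eq))) (2^-split n)
  open ≤-Reasoning
  upper : ∀ n → errorBound (2 * Q) ≤ n → ∀ j → j + H ≡ half n →
    Q * 4 ^ H * countMissing n (2 * m) ≤ Q * x * 2 ^ n + 4 ^ H * 2 ^ n
  upper n le j eq = *-cancelˡ-≤ 2 (begin
    2 * (Q * q * cm)
      ≤⟨ *-monoʳ-≤ 2 (*-monoʳ-≤ (Q * q) (even-≤ n (errorBound>0 (2 * Q) n le) m)) ⟩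
    2 * (Q * q * (w * X (half n) (δ m) + error n))
      ≤⟨ *-monoʳ-≤ 2 (*-monoʳ-≤ (Q * q) (+-monoˡ-≤ (error n) (*-monoʳ-≤ w near))) ⟩
    2 * (Q * q * (w * (4 ^ j * (x + 3 * (1 * t))) + error n))
      ≡⟨ l₁ Q q w (4 ^ j) x t (error n) ⟩
    2 * (Q * x * (w * (4 ^ j * q))) + w * (4 ^ j * q) * (6 * Q * t) + q * (2 * Q * error n)
      ≤⟨ +-mono-≤ (+-monoʳ-≤ (2 * (Q * x * (w * (4 ^ j * q)))) (*-monoʳ-≤ (w * (4 ^ j * q)) small-tail))
           (*-monoʳ-≤ q (error-negligible (2 * Q) n le)) ⟩
    2 * (Q * x * (w * (4 ^ j * q))) + w * (4 ^ j * q) * q + q * 2 ^ n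
      ≡⟨ cong (λ y → 2 * (Q * x * y) + y * q + q * 2 ^ n) (2^-split′ n j eq) ⟩
    2 * (Q * x * 2 ^ n) + 2 ^ n * q + q * 2 ^ n
      ≡⟨ l₂ (Q * x * 2 ^ n) (2 ^ n) q ⟩
    2 * (Q * x * 2 ^ n + q * 2 ^ n) ∎)
    where
    cm = countMissing n (2 * m)
    w = 2 ^ parity n
    q = 4 ^ H
    t = 3 ^ H
    near : X (half n) (δ m) ≤ 4 ^ j * (x + 3 * (1 * t))
    near = ≤-trans (m≤m+n _ _) (subst (λ h → X h (δ m) + 3 * (1 * 3 ^ h) ≤ 4 ^ j * (x + 3 * (1 * t))) eq (X-+-≤ (δ m) 1 (δ≤1 m) j H))
    l₁ : ∀ Q q w s x t e → 2 * (Q * q * (w * (s * (x + 3 * (1 * t))) + e))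
       ≡ 2 * (Q * x * (w * (s * q))) + w * (s * q) * (6 * Q * t) + q * (2 * Q * e)
    l₁ = solve-∀
    l₂ : ∀ a y q → 2 * a + y * q + q * y ≡ 2 * (a + q * y)
    l₂ = solve-∀
  lower : ∀ n → errorBound (2 * Q) ≤ n → ∀ j → j + H ≡ half n →
    Q * x * 2 ^ n ≤ Q * 4 ^ H * countMissing n (2 * m) + 4 ^ H * 2 ^ n
  lower n le j eq = *-cancelˡ-≤ 2 (begin
    2 * (Q * x * 2 ^ n)
      ≡⟨ cong (λ y → 2 * (Q * x * y)) (2^-split′ n j eq) ⟨
    2 * (Q * x * (w * (4 ^ j * q)))
      ≡⟨ l₁ Q x w (4 ^ j) q ⟩
    2 * (Q * q * (w * (4 ^ j * x)))
      ≤⟨ *-monoʳ-≤ 2 (*-monoʳ-≤ (Q * q) (*-monoʳ-≤ w near)) ⟩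
    2 * (Q * q * (w * (X (half n) (δ m) + 4 ^ j * (3 * (1 * t)))))
      ≡⟨ l₂ Q q w (X (half n) (δ m)) (4 ^ j) t ⟩
    2 * (Q * q * (w * X (half n) (δ m))) + w * (4 ^ j * q) * (6 * Q * t)
      ≤⟨ +-mono-≤ (*-monoʳ-≤ 2 (*-monoʳ-≤ (Q * q) (even-≥ n (errorBound>0 (2 * Q) n le) m)))
           (*-monoʳ-≤ (w * (4 ^ j * q)) small-tail) ⟩
    2 * (Q * q * (cm + error n)) + w * (4 ^ j * q) * q
      ≡⟨ cong (λ y → 2 * (Q * q * (cm + error n)) + y * q) (2^-split′ n j eq) ⟩
    2 * (Q * q * (cm + error n)) + 2 ^ n * q
      ≡⟨ l₃ Q q cm (error n) (2 ^ n) ⟩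
    2 * (Q * q * cm) + 2 ^ n * q + q * (2 * Q * error n)
      ≤⟨ +-monoʳ-≤ (2 * (Q * q * cm) + 2 ^ n * q) (*-monoʳ-≤ q (error-negligible (2 * Q) n le)) ⟩
    2 * (Q * q * cm) + 2 ^ n * q + q * 2 ^ n
      ≡⟨ l₄ (Q * q * cm) (2 ^ n) q ⟩
    2 * (Q * q * cm + q * 2 ^ n) ∎)
    where
    cm = countMissing n (2 * m)
    w = 2 ^ parity n
    q = 4 ^ H
    t = 3 ^ H
    near : 4 ^ j * x ≤ X (half n) (δ m) + 4 ^ j * (3 * (1 * t))
    near = ≤-trans (m≤m+n _ _) (subst (λ h → 4 ^ j * x + 3 * (1 * 3 ^ h) ≤ X h (δ m) + 4 ^ j * (3 * (1 * t))) eq (X-+-≥ (δ m) 1 (δ≤1 m) j H))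
    l₁ : ∀ Q x w s q → 2 * (Q * x * (w * (s * q))) ≡ 2 * (Q * q * (w * (s * x)))
    l₁ = solve-∀
    l₂ : ∀ Q q w X s t → 2 * (Q * q * (w * (X + s * (3 * (1 * t))))) ≡ 2 * (Q * q * (w * X)) + w * (s * q) * (6 * Q * t)
    l₂ = solve-∀
    l₃ : ∀ Q q c e y → 2 * (Q * q * (c + e)) + y * q ≡ 2 * (Q * q * c) + y * q + q * (2 * Q * e)
    l₃ = solve-∀
    l₄ : ∀ a y q → 2 * a + y * q + q * y ≡ 2 * (a + q * y)
    l₄ = solve-∀

by-parity : (Q : ℕ → Set) → (∀ m → Q (2 * m)) → (∀ m → Q (suc (2 * m))) → ∀ k → Q k
by-parity Q even odd k = helper (even-or-odd k)
  where
  helper : (∃ λ m → k ≡ 2 * m ⊎ k ≡ suc (2 * m)) → Q k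
  helper (m , inj₁ eq) = subst Q (sym eq) (even m)
  helper (m , inj₂ eq) = subst Q (sym eq) (odd m)

limits-exist : ∀ k → LimitExists (λ n → P n k)
limits-exist = by-parity (λ k → LimitExists (λ n → P n k))
  (λ m → limitExists (2 * m) (even-approx m))
  (λ m → limitExists (suc (2 * m)) (odd-approx m))

-- Positivity, and total mass one

sumW-≥ : ∀ u F → F u ≤ sumW (length u) F
sumW-≥ []          F = ≤-refl
sumW-≥ (false ∷ u) F = ≤-trans (sumW-≥ u (F ∘ (false ∷_))) (m≤m+n _ _)
sumW-≥ (true  ∷ u) F = ≤-trans (sumW-≥ u (F ∘ (true ∷_))) (m≤n+m _ _)

Ext-≤-X : ∀ r u v g → length u ≡ length v → Ext r u v (λ u v → g (miss u v)) ≤ X (length v + r) g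
Ext-≤-X r u v g l = begin
  Ext r u v (λ u v → g (miss u v))
    ≡⟨ Ext-sumW r u v _ ⟩
  sumW r (λ u′ → sumW r (λ v′ → g (miss (u ++ u′) (v′ ++ v))))
    ≤⟨ sumW-mono r (λ u′ _ → ≤-trans (sumW-mono r λ v′ _ → sumW-≥ v (λ v″ → g (miss (u ++ u′) (v′ ++ v″))))
         (≤-reflexive (trans (sym (sumW-++ r (length v) _)) (cong (λ n → sumW n (λ v″ → g (miss (u ++ u′) v″))) (+-comm r (length v)))))) ⟩
  sumW r (λ u′ → sumW (length v + r) (λ v″ → g (miss (u ++ u′) v″)))
    ≤⟨ sumW-≥ u (λ u → sumW r (λ u′ → sumW (length v + r) (λ v″ → g (miss (u ++ u′) v″)))) ⟩
  sumW (length u) (λ u → sumW r (λ u′ → sumW (length v + r) (λ v″ → g (miss (u ++ u′) v″))))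
    ≡⟨ trans (sym (sumW-++ (length u) r _)) (cong (λ n → sumW (n + r) (λ u → sumW (length v + r) (λ v″ → g (miss u v″)))) l) ⟩
  X (length v + r) g ∎
  where open ≤-Reasoning

-- With 0 and 1 in both sets the expected number of further gaps is at most 4/16, so at least 12/16
-- of the extensions have none; with 0 alone the bound would be 1 and give nothing. Each required
-- gap is then produced by a leading zero of A.
X-positive : ∀ m → ∃ λ Q → ∀ r → 4 ^ (m + (2 + r)) ≤ suc Q * X (m + (2 + r)) (δ m)
X-positive zero = 63 , λ r → begin
  4 * (4 * 4 ^ r)                         ≡⟨ *-assoc 4 4 (4 ^ r) ⟨
  16 * 4 ^ r                              ≤⟨ *-monoˡ-≤ (4 ^ r) (≤ᵇ⇒≤ 16 48 _) ⟩
  48 * 4 ^ r                              ≡⟨ *-assoc 4 12 (4 ^ r) ⟩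
  4 * (12 * 4 ^ r)                        ≤⟨ *-monoʳ-≤ 4 (leaf-bound r ones ones (δ 0) 1 1 refl full) ⟩
  4 * (16 * Ext r ones ones (λ u v → δ 0 (miss u v)))
    ≤⟨ *-monoʳ-≤ 4 (*-monoʳ-≤ 16 (Ext-≤-X r ones ones (δ 0) refl)) ⟩
  4 * (16 * X (2 + r) (δ 0))              ≡⟨ *-assoc 4 16 (X (2 + r) (δ 0)) ⟨
  64 * X (2 + r) (δ 0)                    ∎
  where
  open ≤-Reasoning
  ones : Word
  ones = true ∷ true ∷ []
  full : ∀ k → 1 ≤ δ 0 k + 1 * k
  full zero    = ≤-refl
  full (suc k) = s≤s z≤n
X-positive (suc m) =
  let Q , h = X-positive m in 2 * suc Q ∸ 1 , λ r → begin
    4 * 4 ^ (m + (2 + r))                          ≤⟨ *-monoʳ-≤ 4 (h r) ⟩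
    4 * (suc Q * X (m + (2 + r)) (δ m))            ≡⟨ l (suc Q) (X (m + (2 + r)) (δ m)) ⟩
    2 * suc Q * (2 * X (m + (2 + r)) (δ m))        ≤⟨ *-monoʳ-≤ (2 * suc Q) (≤-trans (m≤m+n _ _) (≤-reflexive (sym (X-suc (m + (2 + r)) (δ (suc m)))))) ⟩
    2 * suc Q * X (suc m + (2 + r)) (δ (suc m))    ∎
  where
  open ≤-Reasoning
  l : ∀ q x → 4 * (q * x) ≡ 2 * q * (2 * x)
  l = solve-∀

even-positive : ∀ m → LimitPositive (λ n → P n (2 * m))
-- Doubling `suc Q` gives up half of the main term to the error; `∸ 1` offsets the successor in
-- `limitPositive`.
even-positive m = limitPositive (2 * m) (2 * suc Q ∸ 1) (N , bound)
  where
  Q = proj₁ (X-positive m)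
  N = errorBound (2 * suc Q) ⊔ 2 * (m + 2)
  open ≤-Reasoning
  bound : ∀ n → N ≤ n → 2 ^ n ≤ 2 * suc Q * countMissing n (2 * m)
  bound n le = +-cancelʳ-≤ (2 ^ n) _ _ (begin
    2 ^ n + 2 ^ n
      ≡⟨ cong (λ y → y + y) (2^-split n) ⟨
    w * 4 ^ half n + w * 4 ^ half n
      ≡⟨ l₁ w (4 ^ half n) ⟩
    2 * (w * 4 ^ half n)
      ≤⟨ *-monoʳ-≤ 2 (*-monoʳ-≤ w large) ⟩
    2 * (w * (suc Q * X (half n) (δ m)))
      ≡⟨ l₂ w (suc Q) (X (half n) (δ m)) ⟩
    2 * suc Q * main n (δ m)
      ≤⟨ *-monoʳ-≤ (2 * suc Q) (even-≥ n (errorBound>0 (2 * suc Q) n le₁) m) ⟩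
    2 * suc Q * (countMissing n (2 * m) + error n)
      ≡⟨ *-distribˡ-+ (2 * suc Q) (countMissing n (2 * m)) (error n) ⟩
    2 * suc Q * countMissing n (2 * m) + 2 * suc Q * error n
      ≤⟨ +-monoʳ-≤ _ (error-negligible (2 * suc Q) n le₁) ⟩
    2 * suc Q * countMissing n (2 * m) + 2 ^ n ∎)
    where
    w = 2 ^ parity n
    le₁ : errorBound (2 * suc Q) ≤ n
    le₁ = ≤-trans (m≤m⊔n (errorBound (2 * suc Q)) (2 * (m + 2))) le
    m+2≤h : m + 2 ≤ half n
    m+2≤h = half-≤ (m + 2) n (≤-trans (m≤n⊔m (errorBound (2 * suc Q)) (2 * (m + 2))) le)
    large : 4 ^ half n ≤ suc Q * X (half n) (δ m)
    large = subst (λ h → 4 ^ h ≤ suc Q * X h (δ m))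
      (trans (sym (+-assoc m 2 _)) (m+[n∸m]≡n m+2≤h)) (proj₂ (X-positive m) (half n ∸ (m + 2)))
    l₁ : ∀ w q → w * q + w * q ≡ 2 * (w * q)
    l₁ = solve-∀
    l₂ : ∀ w q x → 2 * (w * (q * x)) ≡ 2 * q * (w * x)
    l₂ = solve-∀

positive⇔even : ∀ k → LimitPositive (λ n → P n k) ⇔ (2 ∣ k)
positive⇔even = by-parity (λ k → LimitPositive (λ n → P n k) ⇔ (2 ∣ k))
  (λ m → mk⇔ (λ _ → m∣m*n m) (λ _ → even-positive m))
  (λ m → mk⇔
    (λ positive → contradiction positive (limitNotPositive (suc (2 * m)) (odd-negligible m)))
    (λ { (divides q eq) → contradiction (trans (*-comm 2 q) (sym eq)) (even≢odd q m) }))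

limits-sum-to-one : LimitsSumToOne
-- The mean number of gaps is at most 3, so `3 * Q` or more gaps have probability at most 1 / Q; a
-- second 1 / Q covers the missing small differences.
limits-sum-to-one = limitsSumToOne λ Q → 2 * (3 * Q) , errorBound Q , λ n le →
  *-cancelˡ-≤ 3 (begin
    3 * (Q * 2 ^ n)
      ≡⟨ *-assoc 3 Q (2 ^ n) ⟨
    3 * Q * 2 ^ n
      ≤⟨ total-≥ n (errorBound>0 Q n le) (3 * Q) ⟩
    3 * Q * Σr (2 * (3 * Q)) (countMissing n) + 3 * Q * error n + 3 * 2 ^ n
      ≡⟨ l₁ Q (Σr (2 * (3 * Q)) (countMissing n)) (error n) (2 ^ n) ⟩
    3 * (Q * Σr (2 * (3 * Q)) (countMissing n) + Q * error n + 2 ^ n)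
      ≤⟨ *-monoʳ-≤ 3 (+-monoˡ-≤ (2 ^ n) (+-monoʳ-≤ (Q * Σr (2 * (3 * Q)) (countMissing n)) (error-negligible Q n le))) ⟩
    3 * (Q * Σr (2 * (3 * Q)) (countMissing n) + 2 ^ n + 2 ^ n)
      ≡⟨ l₂ (Q * Σr (2 * (3 * Q)) (countMissing n)) (2 ^ n) ⟩
    3 * (Q * Σr (2 * (3 * Q)) (countMissing n) + 2 * 2 ^ n) ∎)
  where
  open ≤-Reasoning
  l₁ : ∀ Q s e x → 3 * Q * s + 3 * Q * e + 3 * x ≡ 3 * (Q * s + Q * e + x)
  l₁ = solve-∀
  l₂ : ∀ s x → 3 * (s + x + x) ≡ 3 * (s + 2 * x)
  l₂ = solve-∀

-- Strict inequalities between limits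

-- Multiplying the hypothesis by 4 gives a surplus of 4 · 2^n. The tail `B * 3 ^ h` takes one unit,
-- the error of passing from both counts to `X` takes another, one is spare, and the last is the
-- margin 1 / (4 A).
X-less⇒limitLess : ∀ a b A B H → 0 < A →
  (∀ h → H ≤ h → A * X h (δ a) + 4 ^ h ≤ A * X h (δ b) + B * 3 ^ h) →
  LimitLess (λ n → P n (2 * a)) (λ n → P n (2 * b))
X-less⇒limitLess a b A@(suc _) B H _ hyp = limitLess (2 * a) (2 * b) (4 * A ∸ 1) (N , bound)
  where
  H′ = threshold (4 * B)
  N = errorBound (8 * A) ⊔ 2 * (H ⊔ H′)
  open ≤-Reasoning
  bound : ∀ n → N ≤ n → 4 * A * countMissing n (2 * a) + 2 ^ n ≤ 4 * A * countMissing n (2 * b)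
  bound n le = +-cancelʳ-≤ (3 * 2 ^ n) _ _ (begin
    4 * A * ca + 2 ^ n + 3 * 2 ^ n
      ≡⟨ l₁ A ca (2 ^ n) ⟩
    4 * (A * ca + 2 ^ n)
      ≤⟨ *-monoʳ-≤ 4 (+-monoˡ-≤ (2 ^ n) (*-monoʳ-≤ A (even-≤ n n>0 a))) ⟩
    4 * (A * (w * xa + error n) + 2 ^ n)
      ≡⟨ cong (λ y → 4 * (A * (w * xa + error n) + y)) (2^-split n) ⟨
    4 * (A * (w * xa + error n) + w * 4 ^ h)
      ≡⟨ l₂ A w xa (error n) (4 ^ h) ⟩
    4 * (w * (A * xa + 4 ^ h) + A * error n)
      ≤⟨ *-monoʳ-≤ 4 (+-monoˡ-≤ (A * error n) (*-monoʳ-≤ w (hyp h H≤h))) ⟩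
    4 * (w * (A * xb + B * 3 ^ h) + A * error n)
      ≡⟨ l₃ w A xb B (3 ^ h) (error n) ⟩
    4 * A * (w * xb) + w * (4 * B * 3 ^ h) + 4 * A * error n
      ≤⟨ +-monoˡ-≤ (4 * A * error n) (+-mono-≤ (*-monoʳ-≤ (4 * A) (even-≥ n n>0 b)) (*-monoʳ-≤ w (3^≤4^ (4 * B) h H′≤h))) ⟩
    4 * A * (cb + error n) + w * 4 ^ h + 4 * A * error n
      ≡⟨ cong (λ y → 4 * A * (cb + error n) + y + 4 * A * error n) (2^-split n) ⟩
    4 * A * (cb + error n) + 2 ^ n + 4 * A * error n
      ≡⟨ l₄ A cb (error n) (2 ^ n) ⟩
    4 * A * cb + 2 ^ n + 8 * A * error n
      ≤⟨ +-monoʳ-≤ (4 * A * cb + 2 ^ n) (error-negligible (8 * A) n le₁) ⟩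
    4 * A * cb + 2 ^ n + 2 ^ n
      ≤⟨ m≤m+n _ (2 ^ n) ⟩
    4 * A * cb + 2 ^ n + 2 ^ n + 2 ^ n
      ≡⟨ l₅ (4 * A * cb) (2 ^ n) ⟩
    4 * A * cb + 3 * 2 ^ n ∎)
    where
    ca = countMissing n (2 * a)
    cb = countMissing n (2 * b)
    h = half n
    w = 2 ^ parity n
    xa = X h (δ a)
    xb = X h (δ b)
    le₁ : errorBound (8 * A) ≤ n
    le₁ = ≤-trans (m≤m⊔n (errorBound (8 * A)) (2 * (H ⊔ H′))) le
    n>0 : 0 < n
    n>0 = errorBound>0 (8 * A) n le₁
    H⊔H′≤h : H ⊔ H′ ≤ h
    H⊔H′≤h = half-≤ (H ⊔ H′) n (≤-trans (m≤n⊔m (errorBound (8 * A)) (2 * (H ⊔ H′))) le)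
    H≤h : H ≤ h
    H≤h = ≤-trans (m≤m⊔n H H′) H⊔H′≤h
    H′≤h : H′ ≤ h
    H′≤h = ≤-trans (m≤n⊔m H H′) H⊔H′≤h
    l₁ : ∀ A c y → 4 * A * c + y + 3 * y ≡ 4 * (A * c + y)
    l₁ = solve-∀
    l₂ : ∀ A w x e q → 4 * (A * (w * x + e) + w * q) ≡ 4 * (w * (A * x + q) + A * e)
    l₂ = solve-∀
    l₃ : ∀ w A x B t e → 4 * (w * (A * x + B * t) + A * e) ≡ 4 * A * (w * x) + w * (4 * B * t) + 4 * A * e
    l₃ = solve-∀
    l₄ : ∀ A c e y → 4 * A * (c + e) + y + 4 * A * e ≡ 4 * A * c + y + 8 * A * e
    l₄ = solve-∀
    l₅ : ∀ c y → c + y + y + y ≡ c + 3 * y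
    l₅ = solve-∀

certificate⇒limitLess : ∀ a b K τ fuel ps → T (profileOK K ps) →
  (∀ m → 4 * value K ps m + value K ps (suc (suc m)) + 64 * δ a m
       ≡ 4 * value K ps (suc m) + K + 64 * δ b m) →
  (K * (4 * 16 ^ fuel) <ᵇ lowerBound K τ fuel (true ∷ []) (true ∷ []) ps) ≡ true →
  LimitLess (λ n → P n (2 * a)) (λ n → P n (2 * b))
certificate⇒limitLess a b K τ fuel ps ok shape cert =
  X-less⇒limitLess a b (64 * M) (7 * C * M) (2 + fuel)
    (*-mono-≤ {1} {64} (s≤s z≤n) (*-mono-≤ {1} {4} (s≤s z≤n) (m^n>0 16 fuel)))
    (λ { (suc (suc h)) (s≤s (s≤s f≤h)) → X-less h (m≤n⇒m≤1+n f≤h) })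
  where
  open Comparison a b K τ fuel ps ok shape (<ᵇ⇒< _ _ (subst T (sym cert) _))

-- Numerical certificates

-- The equation 4 (1 - S/2)² g = K + 64 (δ b - δ a), S being the shift. Here 64 = 4 · 16, and 16 is
-- the least factor that makes all (n + 1) / 2^n with n ≤ 5 integers; in each profile below `K` is
-- the least constant that keeps the values nonnegative.
Shape : ℕ → ℕ → ℕ → Profile → Set
Shape a b K ps = ∀ m → 4 * value K ps m + value K ps (suc (suc m)) + 64 * δ a m
                     ≡ 4 * value K ps (suc m) + K + 64 * δ b m

-- `τ` is on the scale of the root denominator `4 * 16 ^ fuel`, so the divisors 500 and 200000 below
-- are reciprocals of the weighted loss tolerated where the search stops early.
Certificate : ℕ → ℕ → ℕ → Profile → Set
Certificate K τ fuel ps = (K * (4 * 16 ^ fuel) <ᵇ lowerBound K τ fuel (true ∷ []) (true ∷ []) ps) ≡ true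

-- The m-th value minus K is 16 times (b - m + 1) / 2 ^ (b - m) - (a - m + 1) / 2 ^ (a - m), each term being
-- present only for m ≤ b or m ≤ a: these are the coefficients of 1 / (1 - x / 2)².
profile₁₀₋₈ profile₈₋₀ profile₀₋₆ profile₆₋₂ profile₂₋₄ : Profile
profile₁₀₋₈ = (18 , 4 , 1) ∷ (19 , 5 , 1) ∷ (20 , 7 , 1) ∷ (20 , 10 , 1) ∷ (16 , 16 , 1) ∷ (0 , 0 , 1) ∷ []
profile₈₋₀  = (27 , 19 , 10) ∷ (8 , 4 , 4) ∷ (4 , 4 , 3) ∷ (0 , 0 , 3) ∷ (0 , 0 , 3) ∷ []
profile₀₋₆  = (0 , 0 , 1) ∷ (20 , 4 , 1) ∷ (24 , 8 , 1) ∷ (24 , 16 , 1) ∷ []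
profile₆₋₂  = (24 , 12 , 1) ∷ (20 , 20 , 1) ∷ (0 , 0 , 1) ∷ (0 , 0 , 1) ∷ []
profile₂₋₄  = (0 , 0 , 7) ∷ (4 , 0 , 6) ∷ (20 , 16 , 10) ∷ []

shape₁₀₋₈ : Shape 5 4 16 profile₁₀₋₈
shape₁₀₋₈ 0 = refl
shape₁₀₋₈ 1 = refl
shape₁₀₋₈ 2 = refl
shape₁₀₋₈ 3 = refl
shape₁₀₋₈ 4 = refl
shape₁₀₋₈ 5 = refl
shape₁₀₋₈ (suc (suc (suc (suc (suc (suc m)))))) = refl

shape₈₋₀ : Shape 4 0 16 profile₈₋₀
shape₈₋₀ 0 = refl
shape₈₋₀ 1 = refl
shape₈₋₀ 2 = refl
shape₈₋₀ 3 = refl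
shape₈₋₀ 4 = refl
shape₈₋₀ (suc (suc (suc (suc (suc m))))) = refl

shape₀₋₆ : Shape 0 3 8 profile₀₋₆
shape₀₋₆ 0 = refl
shape₀₋₆ 1 = refl
shape₀₋₆ 2 = refl
shape₀₋₆ 3 = refl
shape₀₋₆ (suc (suc (suc (suc m)))) = refl

shape₆₋₂ : Shape 3 1 16 profile₆₋₂
shape₆₋₂ 0 = refl
shape₆₋₂ 1 = refl
shape₆₋₂ 2 = refl
shape₆₋₂ 3 = refl
shape₆₋₂ (suc (suc (suc (suc m)))) = refl

shape₂₋₄ : Shape 1 2 4 profile₂₋₄
shape₂₋₄ 0 = refl
shape₂₋₄ 1 = refl
shape₂₋₄ 2 = refl
shape₂₋₄ (suc (suc (suc m))) = refl

-- The stopping thresholds were found by experiment; the two delicate comparisons visit about 200000 nodes each.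
certificate₁₀₋₈ : Certificate 16 (4 * 16 ^ 7 / 500) 7 profile₁₀₋₈
certificate₁₀₋₈ = refl

certificate₈₋₀ : Certificate 16 (4 * 16 ^ 12 / 200000) 12 profile₈₋₀
certificate₈₋₀ = refl

certificate₀₋₆ : Certificate 8 (4 * 16 ^ 7 / 500) 7 profile₀₋₆
certificate₀₋₆ = refl

certificate₆₋₂ : Certificate 16 (4 * 16 ^ 7 / 500) 7 profile₆₋₂
certificate₆₋₂ = refl

certificate₂₋₄ : Certificate 4 (4 * 16 ^ 12 / 200000) 12 profile₂₋₄
certificate₂₋₄ = refl

theorem1p3 : ((k : ℕ) → LimitExists (λ n → P n k))
    × ((k : ℕ) → (LimitPositive (λ n → P n k) ⇔ (2 ∣ k)))
    × LimitsSumToOne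
    × LimitLess (λ n → P n 10) (λ n → P n 8)
    × LimitLess (λ n → P n 8) (λ n → P n 0)
    × LimitLess (λ n → P n 0) (λ n → P n 6)
    × LimitLess (λ n → P n 6) (λ n → P n 2)
    × LimitLess (λ n → P n 2) (λ n → P n 4)
theorem1p3 =
    limits-exist
  , positive⇔even
  , limits-sum-to-one
  , certificate⇒limitLess 5 4 16 (4 * 16 ^ 7 / 500) 7 profile₁₀₋₈ _ shape₁₀₋₈ certificate₁₀₋₈
  , certificate⇒limitLess 4 0 16 (4 * 16 ^ 12 / 200000) 12 profile₈₋₀ _ shape₈₋₀ certificate₈₋₀
  , certificate⇒limitLess 0 3 8 (4 * 16 ^ 7 / 500) 7 profile₀₋₆ _ shape₀₋₆ certificate₀₋₆
  , certificate⇒limitLess 3 1 16 (4 * 16 ^ 7 / 500) 7 profile₆₋₂ _ shape₆₋₂ certificate₆₋₂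
  , certificate⇒limitLess 1 2 4 (4 * 16 ^ 12 / 200000) 12 profile₂₋₄ _ shape₂₋₄ certificate₂₋₄
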